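{- Let $k\ge a\ge 1$ be integers with $k\not\equiv a \pmod 2$. For $n\ge 0$, let $S_{k,a}(n)$ denote the number of lattice paths $L$ (in the sense described in the context) of major index $n$ that start at $(0,k+1-a)$, never go above height $k$, such that for every peak of relative height $k$ or $k-1$ the number of $E$ steps between the starting point and that peak is a multiple of $4$ (hence also the number of $E$ steps between any two such peaks is a multiple of $4$), and such that every peak with weight $x$ and relative height $r$ satisfies $x\equiv r \pmod 2$. Then \[ \sum_{n=0}^{\infty} S_{k,a}(n)q^{n}=\sum_{n_1, n_2, \ldots, n_{k-1} \geq 0}\frac{q^{N_1^2 + N_2^2 + \cdots + N_{k-1}^2 + 2N_a + 2N_{a+2} + \cdots + 2N_{k-1}}\, (-q; q^2)_{n_{k-1}}}{(q^2; q^2)_{n_1} (q^2; q^2)_{n_2} \cdots (q^2; q^2)_{n_{k-2}} (q^4; q^4)_{n_{k-1}}}, \] where $N_i=n_i+n_{i+1}+\cdots+n_{k-1}$ for $1\le i\le k-1$.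
   Context: Notation: $(a;q)_n=\prod_{j=0}^{n-1}(1-aq^j)$. Lattice paths: finite paths in the first quadrant starting on the $y$-axis and ending on the $x$-axis, each step being one of: North-East $NE$: $(x,y)\to(x+1,y+1)$; South-East $SE$: $(x,y)\to(x+1,y-1)$; East $E$: $(x,0)\to(x+1,0)$ (East steps are allowed only along the $x$-axis). Either the path has no steps, or its last step is an $SE$ step. A peak is a vertex preceded by an $NE$ step and followed by an $SE$ step. The height of a vertex $(x,y)$ is $y$ and its weight is $x$. The major index of a path is the sum of the weights of its peaks. The relative height of a peak $(x,y)$ is the largest integer $h$ for which there exist two vertices of the path $(x',y-h)$ and $(x'',y-h)$ with $x'<x<x''$ such that between these two vertices there are no peaks of height greater than $y$, and every peak of height $y$ between them has abscissa at least $x$. -}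

module Defs where

open import Data.Nat using (ℕ; zero; suc; _+_; _*_; _∸_; _≤_; _<_; _%_; _≤ᵇ_; _≡ᵇ_)
open import Data.Nat.Divisibility using (_∣?_)
open import Data.Bool using (Bool; true; false; if_then_else_; _∧_)
open import Data.List using (List; []; _∷_; _++_; length; map; upTo; foldr; concatMap; take)
open import Data.Nat.ListAction using (sum)
open import Data.Empty using (⊥)
open import Data.List.Relation.Unary.Unique.Propositional using (Unique)
open import Data.List.Membership.Propositional using (_∈_)
open import Data.Product using (Σ; ∃; _×_)
open import Data.Sum using (_⊎_)
open import Relation.Nullary using (does)
open import Relation.Binary.PropositionalEquality using (_≡_)

data Step : Set where
  NE SE E : Step

data Walk : ℕ → List Step → Set where
  stop : Walk 0 []
  ne   : ∀ {h s} → Walk (suc h) s → Walk h (NE ∷ s)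
  se   : ∀ {h s} → Walk h s → Walk (suc h) (SE ∷ s)
  e    : ∀ {s} → Walk 0 s → Walk 0 (E ∷ s)

EndsWell : List Step → Set
EndsWell s = s ≡ [] ⊎ Σ (List Step) (λ t → s ≡ t ++ (SE ∷ []))

heightAt : ℕ → List Step → ℕ → ℕ
heightAt h s        zero    = h
heightAt h []       (suc x) = h
heightAt h (NE ∷ s) (suc x) = heightAt (suc h) s x
heightAt h (SE ∷ s) (suc x) = heightAt (h ∸ 1) s x
heightAt h (E ∷ s)  (suc x) = heightAt h s x

data StepAt : List Step → ℕ → Step → Set where
  here  : ∀ {t s} → StepAt (t ∷ s) zero t
  there : ∀ {u s i t} → StepAt s i t → StepAt (u ∷ s) (suc i) t

-- the vertex of abscissa x is a peak: preceded by NE, followed by SE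
-- (step number j goes from vertex j to vertex j+1)
IsPeak : List Step → ℕ → Set
IsPeak s zero    = ⊥
IsPeak s (suc j) = StepAt s j NE × StepAt s (suc j) SE

majorFrom : ℕ → List Step → ℕ
majorFrom i (NE ∷ SE ∷ s) = suc i + majorFrom (suc i) (SE ∷ s)
majorFrom i (_ ∷ s)       = majorFrom (suc i) s
majorFrom i []            = 0

majorIndex : List Step → ℕ
majorIndex = majorFrom 0

countE : List Step → ℕ
countE []       = 0
countE (E ∷ s)  = suc (countE s)
countE (_ ∷ s)  = countE s

RelAdmissible : ℕ → List Step → ℕ → ℕ → Set
RelAdmissible h0 s x h =
  Σ ℕ λ x′ → Σ ℕ λ x″ →
    x′ < x × x < x″ × x″ ≤ length s ×
    heightAt h0 s x′ + h ≡ heightAt h0 s x ×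
    heightAt h0 s x″ + h ≡ heightAt h0 s x ×
    (∀ z → x′ < z → z < x″ → IsPeak s z →
       heightAt h0 s z ≤ heightAt h0 s x ×
       (heightAt h0 s z ≡ heightAt h0 s x → x ≤ z))

IsRelHeight : ℕ → List Step → ℕ → ℕ → Set
IsRelHeight h0 s x r = RelAdmissible h0 s x r × (∀ h → RelAdmissible h0 s x h → h ≤ r)

SPath : ℕ → ℕ → ℕ → List Step → Set
SPath k a n s =
  Walk (suc k ∸ a) s × EndsWell s ×
  (∀ x → x ≤ length s → heightAt (suc k ∸ a) s x ≤ k) ×
  (∀ x r → IsPeak s x → IsRelHeight (suc k ∸ a) s x r →
     r ≡ k ⊎ r ≡ k ∸ 1 → countE (take x s) % 4 ≡ 0) ×
  (∀ x r → IsPeak s x → IsRelHeight (suc k ∸ a) s x r → x % 2 ≡ r % 2) ×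
  majorIndex s ≡ n

HasCount : {A : Set} → (A → Set) → ℕ → Set
HasCount {A} P c = Σ (List A) λ L →
  Unique L × (∀ s → s ∈ L → P s) × (∀ s → P s → s ∈ L) × length L ≡ c

Series : Set
Series = ℕ → ℕ

_⊕_ : Series → Series → Series
(f ⊕ g) d = f d + g d

_⊛_ : Series → Series → Series
(f ⊛ g) d = sum (map (λ i → f i * g (d ∸ i)) (upTo (suc d)))

zeroS : Series
zeroS _ = 0

mono : ℕ → Series
mono m d = if m ≡ᵇ d then 1 else 0

oneS : Series
oneS = mono 0

-- 1/(1 - q^m) = Σ_t q^(m t)   (used only with m ≥ 1)
geom : ℕ → Series
geom m d = if does (m ∣? d) then 1 else 0

prodS : List Series → Series
prodS = foldr _⊛_ oneS

sumS : List Series → Series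
sumS = foldr _⊕_ zeroS

negqq2 : ℕ → Series
negqq2 n = prodS (map (λ j → oneS ⊕ mono (suc (2 * j))) (upTo n))

invq2q2 : ℕ → Series
invq2q2 n = prodS (map (λ j → geom (2 * suc j)) (upTo n))

invq4q4 : ℕ → Series
invq4q4 n = prodS (map (λ j → geom (4 * suc j)) (upTo n))

suffixSums : List ℕ → List ℕ
suffixSums []       = []
suffixSums (x ∷ xs) = (x + sum xs) ∷ suffixSums xs

-- Σ_{i ≥ a, i ≡ a mod 2} N_i, where the list starts at index i
parSum : ℕ → ℕ → List ℕ → ℕ
parSum a i []       = 0
parSum a i (N ∷ Ns) =
  (if (a ≤ᵇ i) ∧ (((i ∸ a) % 2) ≡ᵇ 0) then N else 0) + parSum a (suc i) Ns

expo : ℕ → List ℕ → ℕ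
expo a ns = sum (map (λ N → N * N) (suffixSums ns)) + 2 * parSum a 1 (suffixSums ns)

factor : List ℕ → Series
factor []           = oneS
factor (x ∷ [])     = negqq2 x ⊛ invq4q4 x
factor (x ∷ y ∷ ns) = invq2q2 x ⊛ factor (y ∷ ns)

term : ℕ → List ℕ → Series
term a ns = mono (expo a ns) ⊛ factor ns

tuples : ℕ → ℕ → List (List ℕ)
tuples zero    B = [] ∷ []
tuples (suc m) B = concatMap (λ x → map (x ∷_) (tuples m B)) (upTo (suc B))

rhsTrunc : ℕ → ℕ → ℕ → Series
rhsTrunc k a B = sumS (map (term a) (tuples (k ∸ 1) B))

module Submission where

open import Defs
open import Data.Nat hiding (parity)
open import Data.Nat.Properties
open import Data.Nat.Divisibility using (_∣?_; divides)
open import Data.Nat.ListAction using (sum)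
open import Data.Nat.Solver using (module +-*-Solver)
open import Data.Bool using (Bool; true; false; if_then_else_)
open import Data.Unit using (⊤; tt)
open import Data.Empty using (⊥; ⊥-elim)
open import Data.Product using (Σ; ∃; ∃₂; _×_; _,_; proj₁; proj₂)
open import Data.Sum as Sum using (_⊎_; inj₁; inj₂)
open import Data.List using (List; []; _∷_; _++_; [_]; length; map; upTo; downFrom; concatMap; take; foldr; reverse; cartesianProduct)
open import Data.List.Properties using (length-map; length-++; unfold-reverse; reverse-involutive; reverse-injective; reverse-downFrom; length-downFrom; length-reverse; length-upTo; map-injective; ∷-injectiveˡ; ∷-injectiveʳ)
open import Data.List.Membership.Propositional using (_∈_)
open import Data.List.Membership.Propositional.Properties using (∈-map⁺; ∈-map⁻; ∈-++⁺ˡ; ∈-++⁺ʳ; ∈-++⁻; ∈-upTo⁺; ∈-upTo⁻; ∈-cartesianProduct⁺; ∈-cartesianProduct⁻)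
open import Data.List.Relation.Unary.Any using (here; there)
open import Data.List.Relation.Unary.All as All using (All; []; _∷_)
open import Data.List.Relation.Unary.AllPairs using ([]; _∷_)
open import Data.List.Relation.Unary.Unique.Propositional using (Unique)
import Data.List.Relation.Unary.Unique.Propositional.Properties as Uniqueₚ
open import Relation.Nullary using (¬_; yes; no)
open import Relation.Nullary.Decidable using (dec-true; dec-false)
open import Relation.Binary.PropositionalEquality hiding ([_])
open import Function using (_∘_; id)

-- Inserting NE SE once at every peak of a path w (continued by E steps for ever) raises the
-- relative heights of its peaks by one, and inserting n further copies of NE SE anywhere creates
-- n peaks of relative height 1. The i-th inserted peak, i = 0, 1, …, has abscissa x + 2 i + 1 if
-- it is inserted at abscissa x, so the major index grows by N² plus the sum of the abscissae of
-- the n further insertions, where N is the new number of peaks; the parity condition says that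
-- these abscissae are even, which gives q^(N²) / (q²;q²)_n. Every path arises in this way exactly
-- once. This lowers k and a by one; if a = 1 the path starts with SE SE, and removing these two
-- steps lowers the major index by 2 N. At k = 2 the path is SE SE followed by blocks
-- E^(4t) NE SE and E^(4t) NE NE SE SE, which gives q^(n²+2n) (-q;q²)_n / (q⁴;q⁴)_n.

-- Counting

-- The tie rule in the definition of relative height singles out the leftmost of several equally
-- high peaks. Hence, of all copies of NE SE inserted at a peak of w, only the first inherits its
-- relative height plus one; every further copy has relative height 1. The continuation by E steps
-- admits peaks beyond the end of w; in return w must not end with E, or the decomposition would not
-- be unique. Lowering k and a together keeps the starting height k + 1 - a. For a = 1 this height
-- is k, too high for paths bounded by k - 1. After the two SE steps the height is k - 2, which is
-- the starting height of the pair (k - 1, 2); its entries again differ in parity. The reduction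
-- stops at k = 2 because the condition on E steps concerns the relative heights k and k - 1: new
-- peaks, of relative height 1, escape it only if k - 1 > 1.

map-unique : ∀ {A B : Set} (f : A → B) {xs : List A} →
  (∀ {x y} → x ∈ xs → y ∈ xs → f x ≡ f y → x ≡ y) → Unique xs → Unique (map f xs)
map-unique f inj [] = []
map-unique {A} {B} f {x ∷ xs} inj (x∉xs ∷ u) =
  fresh xs x∉xs (λ y∈ → inj (here refl) (there y∈)) ∷ map-unique f (λ p q → inj (there p) (there q)) u
  where
  fresh : ∀ ys → All (x ≢_) ys → (∀ {y} → y ∈ ys → f x ≡ f y → x ≡ y) → All (f x ≢_) (map f ys)
  fresh []       []         _ = []
  fresh (y ∷ ys) (x≢y ∷ ps) g = (λ eq → x≢y (g (here refl) eq)) ∷ fresh ys ps (λ m → g (there m))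

count-image : ∀ {A B : Set} {P : A → Set} {Q : B → Set} (f : A → B) →
  (∀ a → P a → Q (f a)) → (∀ {a a′} → P a → P a′ → f a ≡ f a′ → a ≡ a′) →
  (∀ b → Q b → ∃ λ a → P a × f a ≡ b) →
  ∀ {c} → HasCount P c → HasCount Q c
count-image {Q = Q} f pq inj onto (L , uniq , sound , complete , len) =
  map f L ,
  map-unique f (λ x∈ y∈ → inj (sound _ x∈) (sound _ y∈)) uniq ,
  (λ b b∈ → let a , a∈ , b≡ = ∈-map⁻ f b∈ in subst Q (sym b≡) (pq a (sound a a∈))) ,
  (λ b qb → let a , pa , eq = onto b qb in subst (_∈ map f L) eq (∈-map⁺ f (complete a pa))) ,
  trans (length-map f L) len

count-cong : ∀ {A : Set} {P Q : A → Set} → (∀ a → P a → Q a) → (∀ a → Q a → P a) →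
  ∀ {c} → HasCount P c → HasCount Q c
count-cong pq qp = count-image id pq (λ _ _ eq → eq) (λ b q → b , qp b q , refl)

count-none : ∀ {A : Set} {P : A → Set} → (∀ a → ¬ P a) → HasCount P 0
count-none none = [] , [] , (λ _ ()) , (λ a pa → ⊥-elim (none a pa)) , refl

count-one : ∀ {A : Set} {P : A → Set} (x : A) → P x → (∀ a → P a → a ≡ x) → HasCount P 1
count-one x px only =
  x ∷ [] , [] ∷ [] , (λ { _ (here refl) → px }) , (λ a pa → here (only a pa)) , refl

count-⊎ : ∀ {A : Set} {P Q : A → Set} {c d} → (∀ a → P a → Q a → ⊥) →
  HasCount P c → HasCount Q d → HasCount (λ a → P a ⊎ Q a) (c + d)
count-⊎ disj (L , uL , sL , cL , lL) (M , uM , sM , cM , lM) =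
  L ++ M ,
  Uniqueₚ.++⁺ uL uM (λ { (p , q) → disj _ (sL _ p) (sM _ q) }) ,
  (λ a a∈ → Sum.map (sL a) (sM a) (∈-++⁻ L a∈)) ,
  (λ { a (inj₁ p) → ∈-++⁺ˡ (cL a p) ; a (inj₂ q) → ∈-++⁺ʳ L (cM a q) }) ,
  trans (length-++ L) (cong₂ _+_ lL lM)

length-cartesianProduct : ∀ {A B : Set} (xs : List A) (ys : List B) →
  length (cartesianProduct xs ys) ≡ length xs * length ys
length-cartesianProduct []       ys = refl
length-cartesianProduct (x ∷ xs) ys =
  trans (length-++ (map (x ,_) ys)) (cong₂ _+_ (length-map (x ,_) ys) (length-cartesianProduct xs ys))

count-× : ∀ {A B : Set} {P : A → Set} {Q : B → Set} {c d} →
  HasCount P c → HasCount Q d → HasCount (λ ab → P (proj₁ ab) × Q (proj₂ ab)) (c * d)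
count-× (L , uL , sL , cL , lL) (M , uM , sM , cM , lM) =
  cartesianProduct L M ,
  Uniqueₚ.cartesianProduct⁺ uL uM ,
  (λ { (a , b) ab∈ → let a∈ , b∈ = ∈-cartesianProduct⁻ L M ab∈ in sL a a∈ , sM b b∈ }) ,
  (λ { (a , b) (p , q) → ∈-cartesianProduct⁺ (cL a p) (cM b q) }) ,
  trans (length-cartesianProduct L M) (cong₂ _*_ lL lM)

-- Distinct indices have disjoint fibres, so the counts add up. This serves both the Cauchy product,
-- indexed by the weight of the first component, and the final sum over tuples.
count-fibres : ∀ {A I : Set} {P : A → Set} (idx : A → I) (c : I → ℕ) (is : List I) → Unique is →
  (∀ i → i ∈ is → HasCount (λ a → P a × idx a ≡ i) (c i)) →
  HasCount (λ a → P a × idx a ∈ is) (sum (map c is))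
count-fibres idx c []       _          _   = count-none (λ { _ (_ , ()) })
count-fibres {P = P} idx c (i ∷ is) (i∉is ∷ u) fib =
  count-cong
    (λ { a (inj₁ (p , refl)) → p , here refl ; a (inj₂ (p , m)) → p , there m })
    (λ { a (p , here eq) → inj₁ (p , eq) ; a (p , there m) → inj₂ (p , m) })
    (count-⊎ (λ { a (_ , refl) (_ , m) → All.lookup i∉is m refl })
      (fib i (here refl))
      (count-fibres idx c is u (λ j j∈ → fib j (there j∈))))

-- `f` is the generating function of `P` by the weight `wt`.
Enum : {A : Set} → (A → Set) → (A → ℕ) → Series → Set
Enum P wt f = ∀ n → HasCount (λ a → P a × wt a ≡ n) (f n)

enum-× : ∀ {A B : Set} {P : A → Set} {Q : B → Set} {v : A → ℕ} {w : B → ℕ} {f g} →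
  Enum P v f → Enum Q w g →
  Enum (λ ab → P (proj₁ ab) × Q (proj₂ ab)) (λ ab → v (proj₁ ab) + w (proj₂ ab)) (f ⊛ g)
enum-× {P = P} {Q} {v} {w} {f} {g} p q n =
  count-cong
    (λ { _ (h , _) → h })
    (λ { ab h@(_ , eq) → h , ∈-upTo⁺ (s≤s (subst (v (proj₁ ab) ≤_) eq (m≤m+n _ _))) })
    (count-fibres (λ ab → v (proj₁ ab)) (λ i → f i * g (n ∸ i)) (upTo (suc n)) (Uniqueₚ.upTo⁺ (suc n))
      (λ i i∈ → count-cong
        (λ { ab ((pa , refl) , (qb , eq)) →
              ((pa , qb) , trans (cong (v (proj₁ ab) +_) eq) (m+[n∸m]≡n (≤-pred (∈-upTo⁻ i∈)))) , refl })
        (λ { ab (((pa , qb) , refl) , refl) → (pa , refl) , (qb , sym (m+n∸m≡n (v (proj₁ ab)) _)) })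
        (count-× (p i) (q (n ∸ i)))))

enum-image : ∀ {A B : Set} {P : A → Set} {Q : B → Set} {v : A → ℕ} {w : B → ℕ} {h} (f : A → B) →
  (∀ a → P a → Q (f a)) → (∀ {a a′} → P a → P a′ → f a ≡ f a′ → a ≡ a′) →
  (∀ b → Q b → ∃ λ a → P a × f a ≡ b) →
  (∀ a → P a → w (f a) ≡ v a) → Enum P v h → Enum Q w h
enum-image {w = w} f pq inj onto weq en n =
  count-image f
    (λ { a (p , eq) → pq a p , trans (weq a p) eq })
    (λ { (p , _) (p′ , _) → inj p p′ })
    (λ { b (q , wb) → let a , p , fa = onto b q in
          a , (p , trans (sym (weq a p)) (trans (cong w fa) wb)) , fa })
    (en n)

mono-same : ∀ m → mono m m ≡ 1
mono-same m with m ≡ᵇ m | ≡⇒≡ᵇ m m refl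
... | true | _ = refl

mono-diff : ∀ {m n} → m ≢ n → mono m n ≡ 0
mono-diff {m} {n} m≢n with m ≡ᵇ n | ≡ᵇ⇒≡ m n
... | true  | h = ⊥-elim (m≢n (h tt))
... | false | _ = refl

enum-mono : ∀ m → Enum {⊤} (λ _ → ⊤) (λ _ → m) (mono m)
enum-mono m n with m ≟ n
... | yes refl = subst (HasCount _) (sym (mono-same m)) (count-one tt (tt , refl) (λ _ _ → refl))
... | no m≢n   = subst (HasCount _) (sym (mono-diff m≢n)) (count-none (λ { _ (_ , eq) → m≢n eq }))

enum-shift : ∀ {A : Set} {P : A → Set} {w : A → ℕ} {f} m →
  Enum P w f → Enum P (λ a → m + w a) (mono m ⊛ f)
enum-shift m en = enum-image {P = λ ab → ⊤ × _} proj₂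
  (λ _ → proj₂) (λ _ _ eq → cong (tt ,_) eq) (λ a p → (tt , a) , (tt , p) , refl) (λ _ _ → refl)
  (enum-× (enum-mono m) en)

enum-bit : ∀ m → Enum {Bool} (λ _ → ⊤) (if_then m else 0) (oneS ⊕ mono m)
enum-bit m n = count-cong
  (λ { false (inj₁ (_ , eq)) → tt , eq ; true (inj₂ (_ , eq)) → tt , eq ; true (inj₁ (() , _)) ; false (inj₂ (() , _)) })
  (λ { false (_ , eq) → inj₁ (refl , eq) ; true (_ , eq) → inj₂ (refl , eq) })
  (count-⊎ {P = λ b → b ≡ false × 0 ≡ n} {Q = λ b → b ≡ true × m ≡ n}
    (λ { _ (refl , _) (() , _) })
    (count-image (λ _ → false) (λ { _ (_ , eq) → refl , eq }) (λ _ _ _ → refl)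
      (λ { _ (refl , eq) → tt , (tt , eq) , refl }) (enum-mono 0 n))
    (count-image (λ _ → true) (λ { _ (_ , eq) → refl , eq }) (λ _ _ _ → refl)
      (λ { _ (refl , eq) → tt , (tt , eq) , refl }) (enum-mono m n)))

enum-geom : ∀ m → Enum {ℕ} (λ _ → ⊤) (λ t → suc m * t) (geom (suc m))
enum-geom m n with suc m ∣? n
... | yes (divides t refl) =
        subst (HasCount _) (sym (cong (if_then 1 else 0) (dec-true (suc m ∣? t * suc m) (divides t refl))))
          (count-one t (tt , *-comm (suc m) t)
            (λ { a (_ , eq) → *-cancelˡ-≡ a t (suc m) (trans eq (*-comm t (suc m))) }))
... | no ∤n =
        subst (HasCount _) (sym (cong (if_then 1 else 0) (dec-false (suc m ∣? n) ∤n)))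
          (count-none (λ { a (_ , eq) → ∤n (divides a (trans (sym eq) (*-comm (suc m) a))) }))

-- Lists whose entries are weighted according to their position

module _ {C : Set} (w : ℕ → C → ℕ) where

  wtUp : List ℕ → List C → ℕ
  wtUp (j ∷ js) (c ∷ cs) = w j c + wtUp js cs
  wtUp _        _        = 0

  wtDown : List C → ℕ
  wtDown []       = 0
  wtDown (c ∷ cs) = w (length cs) c + wtDown cs

  wtUp-snoc : ∀ js cs j c → length cs ≡ length js → wtUp (js ++ [ j ]) (cs ++ [ c ]) ≡ wtUp js cs + w j c
  wtUp-snoc []       []       j c _  = +-identityʳ _
  wtUp-snoc (i ∷ js) (b ∷ cs) j c eq =
    trans (cong (w i b +_) (wtUp-snoc js cs j c (suc-injective eq))) (sym (+-assoc (w i b) _ _))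

  wtUp-reverse : ∀ cs → wtUp (reverse (downFrom (length cs))) (reverse cs) ≡ wtDown cs
  wtUp-reverse []       = refl
  wtUp-reverse (c ∷ cs) = begin
    wtUp (reverse (downFrom (suc (length cs)))) (reverse (c ∷ cs))
      ≡⟨ cong₂ wtUp (unfold-reverse (length cs) (downFrom (length cs))) (unfold-reverse c cs) ⟩
    wtUp (reverse (downFrom (length cs)) ++ [ length cs ]) (reverse cs ++ [ c ])
      ≡⟨ wtUp-snoc (reverse (downFrom (length cs))) (reverse cs) (length cs) c lengths ⟩
    wtUp (reverse (downFrom (length cs))) (reverse cs) + w (length cs) c
      ≡⟨ cong (_+ w (length cs) c) (wtUp-reverse cs) ⟩
    wtDown cs + w (length cs) c
      ≡⟨ +-comm (wtDown cs) _ ⟩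
    w (length cs) c + wtDown cs ∎
    where
    open ≡-Reasoning
    lengths : length (reverse cs) ≡ length (reverse (downFrom (length cs)))
    lengths = trans (length-reverse cs)
      (sym (trans (length-reverse (downFrom (length cs))) (length-downFrom (length cs))))

  module _ {f : ℕ → Series} (enum-w : ∀ j → Enum (λ _ → ⊤) (w j) (f j)) where

    enum-wtUp : ∀ js → Enum (λ cs → length cs ≡ length js) (wtUp js) (prodS (map f js))
    enum-wtUp [] = enum-image (λ _ → []) (λ _ _ → refl) (λ _ _ _ → refl)
      (λ { [] _ → tt , tt , refl }) (λ _ _ → refl) (enum-mono 0)
    enum-wtUp (j ∷ js) = enum-image
      (λ { (c , cs) → c ∷ cs })
      (λ { _ (_ , p) → cong suc p })
      (λ { _ _ refl → refl })
      (λ { (c ∷ cs) p → (c , cs) , (tt , suc-injective p) , refl ; [] () })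
      (λ _ _ → refl)
      (enum-× (enum-w j) (enum-wtUp js))

    -- In `wtDown` an entry is weighted by the number of entries after it, so the head has the
    -- largest index, whereas the product over `upTo n` begins with index 0; hence the reversal.
    enum-wtDown : ∀ n → Enum (λ cs → length cs ≡ n) wtDown (prodS (map f (upTo n)))
    enum-wtDown n = enum-image reverse
      (λ cs p → trans (length-reverse cs) (trans p (length-upTo n)))
      (λ _ _ → reverse-injective)
      (λ cs p → reverse cs , trans (length-reverse cs) (trans p (sym (length-upTo n))) , reverse-involutive cs)
      (λ cs p → trans (sym (wtUp-reverse (reverse cs)))
        (cong₂ wtUp
          (trans (cong (reverse ∘ downFrom) (trans (length-reverse cs) (trans p (length-upTo n))))
            (reverse-downFrom n))
          (reverse-involutive cs)))
      (enum-wtUp (upTo n))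

-- Heights and peaks

stepAt : ∀ s {i} → i < length s → ∃ (StepAt s i)
stepAt (t ∷ s) {zero}  _         = t , here
stepAt (t ∷ s) {suc i} (s≤s i<) = let u , at = stepAt s i< in u , there at

stepAt-< : ∀ {s i t} → StepAt s i t → i < length s
stepAt-< here       = s≤s z≤n
stepAt-< (there at) = s≤s (stepAt-< at)

stepAt-det : ∀ {s i t u} → StepAt s i t → StepAt s i u → t ≡ u
stepAt-det here       here        = refl
stepAt-det (there at) (there at′) = stepAt-det at at′

height-[] : ∀ h x → heightAt h [] x ≡ h
height-[] h zero    = refl
height-[] h (suc x) = refl

height-NE : ∀ h {s i} → StepAt s i NE → heightAt h s (suc i) ≡ suc (heightAt h s i)
height-NE h {i = zero} here = refl
height-NE h (there {u = NE} at) = height-NE (suc h) at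
height-NE h (there {u = SE} at) = height-NE (h ∸ 1) at
height-NE h (there {u = E}  at) = height-NE h at

height-SE : ∀ {h s i} → Walk h s → StepAt s i SE → heightAt h s i ≡ suc (heightAt h s (suc i))
height-SE (se w) here       = refl
height-SE (ne w) (there at) = height-SE w at
height-SE (se w) (there at) = height-SE w at
height-SE (e w)  (there at) = height-SE w at

height-E : ∀ {h s i} → Walk h s → StepAt s i E → heightAt h s i ≡ 0 × heightAt h s (suc i) ≡ 0
height-E (e w)  here       = refl , refl
height-E (ne w) (there at) = height-E w at
height-E (se w) (there at) = height-E w at
height-E (e w)  (there at) = height-E w at

height-end : ∀ {h s} → Walk h s → heightAt h s (length s) ≡ 0
height-end stop   = refl
height-end (ne w) = height-end w
height-end (se w) = height-end w
height-end (e w)  = height-end w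

height-rise : ∀ h s i → heightAt h s (suc i) ≤ suc (heightAt h s i)
height-rise h []       i       = ≤-trans (≤-reflexive (sym (height-[] h i))) (n≤1+n _)
height-rise h (NE ∷ s) zero    = ≤-refl
height-rise h (SE ∷ s) zero    = ≤-trans (m∸n≤m h 1) (n≤1+n h)
height-rise h (E ∷ s)  zero    = n≤1+n h
height-rise h (NE ∷ s) (suc i) = height-rise (suc h) s i
height-rise h (SE ∷ s) (suc i) = height-rise (h ∸ 1) s i
height-rise h (E ∷ s)  (suc i) = height-rise h s i

height-fall : ∀ h s i → heightAt h s i ≤ suc (heightAt h s (suc i))
height-fall h []       i       = ≤-trans (≤-reflexive (height-[] h i)) (n≤1+n _)
height-fall h (NE ∷ s) zero    = ≤-trans (n≤1+n h) (n≤1+n _)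
height-fall zero    (SE ∷ s) zero = z≤n
height-fall (suc h) (SE ∷ s) zero = ≤-refl
height-fall h (E ∷ s)  zero    = n≤1+n h
height-fall h (NE ∷ s) (suc i) = height-fall (suc h) s i
height-fall h (SE ∷ s) (suc i) = height-fall (h ∸ 1) s i
height-fall h (E ∷ s)  (suc i) = height-fall h s i

peak-≤length : ∀ {s x} → IsPeak s x → x ≤ length s
peak-≤length {x = suc x} (_ , down) = <⇒≤ (stepAt-< down)

adjacent-not-peak : ∀ {s x} → IsPeak s x → ¬ IsPeak s (suc x)
adjacent-not-peak {x = suc x} (_ , down) (up , _) with () ← stepAt-det down up

-- A step rises by at most one, so walking back from j cannot skip the height T.
height-crosses-up : ∀ h s {i j} T → i ≤ j → heightAt h s i ≤ T → T ≤ heightAt h s j →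
  ∃ λ m → i ≤ m × m ≤ j × heightAt h s m ≡ T
height-crosses-up h s {i} {j} T i≤j lo hi with heightAt h s j ≟ T
... | yes eq = j , i≤j , ≤-refl , eq
... | no neq with m≤n⇒m<n∨m≡n i≤j
...   | inj₂ refl = ⊥-elim (neq (≤-antisym lo hi))
height-crosses-up h s {i} {suc j} T _ lo hi | no neq | inj₁ (s≤s i≤j) =
  let m , i≤m , m≤j , eq = height-crosses-up h s T i≤j lo
                            (≤-pred (≤-trans (≤∧≢⇒< hi (λ q → neq (sym q))) (height-rise h s j)))
  in m , i≤m , m≤n⇒m≤1+n m≤j , eq

height-crosses-down : ∀ h s {i j} T → i ≤ j → T ≤ heightAt h s i → heightAt h s j ≤ T →
  ∃ λ m → i ≤ m × m ≤ j × heightAt h s m ≡ T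
height-crosses-down h s {i} {j} T i≤j hi lo with heightAt h s j ≟ T
... | yes eq = j , i≤j , ≤-refl , eq
... | no neq with m≤n⇒m<n∨m≡n i≤j
...   | inj₂ refl = ⊥-elim (neq (≤-antisym lo hi))
height-crosses-down h s {i} {suc j} T _ hi lo | no neq | inj₁ (s≤s i≤j) =
  let m , i≤m , m≤j , eq = height-crosses-down h s T i≤j hi
                            (≤-trans (height-fall h s j) (≤∧≢⇒< lo neq))
  in m , i≤m , m≤n⇒m≤1+n m≤j , eq

-- Follow the NE steps until another step comes. It cannot be E, since the height is positive after
-- an NE step, so it is SE and ends the ascent in a peak. The distance d from i to j decreases along
-- the way.
peak-right : ∀ {h s} → Walk h s → ∀ d {i j} → i + d ≡ j → StepAt s i NE → i < j → j ≤ length s →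
  heightAt h s j ≤ heightAt h s i →
  ∃ λ p → i < p × p < j × IsPeak s p × heightAt h s i < heightAt h s p
peak-right W zero {i} eq up i<j _ _ = ⊥-elim (<-irrefl (trans (sym (+-identityʳ i)) eq) i<j)
peak-right {h} {s} W (suc d) {i} {j} eq up i<j j≤ lo
  with m≤n⇒m<n∨m≡n i<j
... | inj₂ refl = ⊥-elim (<-irrefl refl (≤-trans (≤-reflexive (sym (height-NE h up))) lo))
... | inj₁ i+1<j with stepAt s (≤-trans i+1<j j≤)
...   | SE , at = suc i , ≤-refl , i+1<j , (up , at) , ≤-reflexive (sym (height-NE h up))
...   | E  , at = ⊥-elim (1+n≢0 (trans (sym (height-NE h up)) (proj₁ (height-E W at))))
...   | NE , at =
        let p , a , b , pk , c = peak-right W d (trans (sym (+-suc i d)) eq) at i+1<j j≤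
                                   (≤-trans lo (≤-trans (n≤1+n _) (≤-reflexive (sym (height-NE h up)))))
        in p , <-trans ≤-refl a , b , pk , <-trans (≤-reflexive (sym (height-NE h up))) c

peak-left : ∀ {h s} → Walk h s → ∀ {i} j → StepAt s j SE → i ≤ j →
  heightAt h s i ≤ heightAt h s (suc j) →
  ∃ λ p → i < p × p < suc j × IsPeak s p × heightAt h s (suc j) < heightAt h s p
peak-left {h} {s} W {i} j down i≤j lo with m≤n⇒m<n∨m≡n i≤j
... | inj₂ refl = ⊥-elim (<-irrefl refl (≤-trans (≤-reflexive (sym (height-SE W down))) lo))
peak-left {h} {s} W {i} (suc j) down _ lo | inj₁ (s≤s i≤j)
  with stepAt s (<-trans ≤-refl (stepAt-< down))
...   | NE , at = suc j , s≤s i≤j , ≤-refl , (at , down) , ≤-reflexive (sym (height-SE W down))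
...   | E  , at = ⊥-elim (1+n≢0 (trans (sym (height-SE W down)) (proj₂ (height-E W at))))
...   | SE , at =
        let p , a , b , pk , c = peak-left W j at i≤j
                                   (≤-trans lo (≤-trans (n≤1+n _) (≤-reflexive (sym (height-SE W down)))))
        in p , a , <-trans b ≤-refl , pk , <-trans (≤-reflexive (sym (height-SE W down))) c

-- If the step after x is NE, or the step before it is SE, the path is higher next to x and has to
-- turn at a higher peak before reaching j or after leaving i. This transfers bounds on peaks, the
-- only ones that relative heights provide, to all vertices.
climb : ∀ {h s} → Walk h s → ∀ {i x j} → i < x → x < j → j ≤ length s →
  heightAt h s i < heightAt h s x → heightAt h s j < heightAt h s x →
  IsPeak s x ⊎ ∃ λ p → i < p × p < j × IsPeak s p × heightAt h s x < heightAt h s p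
climb {h} {s} W {i} {suc x} {j} (s≤s i≤x) x<j j≤ lo hi
  with stepAt s (≤-trans x<j j≤)
... | NE , at =
      let p , a , b , pk , c = peak-right W (j ∸ suc x) (m+[n∸m]≡n (<⇒≤ x<j)) at x<j j≤ (<⇒≤ hi)
      in inj₂ (p , <-trans (s≤s i≤x) a , b , pk , c)
... | E , at = ⊥-elim (m<n⇒n≢0 lo (proj₁ (height-E W at)))
... | SE , at with stepAt s (<-trans ≤-refl (≤-trans x<j j≤))
...   | NE , at′ = inj₁ (at′ , at)
...   | E  , at′ = ⊥-elim (m<n⇒n≢0 lo (proj₂ (height-E W at′)))
...   | SE , at′ =
        let p , a , b , pk , c = peak-left W x at′ i≤x (<⇒≤ lo)
        in inj₂ (p , a , <-trans b x<j , pk , c)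

-- The map `π` may lower the end vertices of a window by one relative to its peak, so exact depths
-- do not survive it and inequalities are needed.
RelAdmissible≤ : ℕ → List Step → ℕ → ℕ → Set
RelAdmissible≤ h0 s x h =
  Σ ℕ λ x′ → Σ ℕ λ x″ →
    x′ < x × x < x″ × x″ ≤ length s ×
    heightAt h0 s x′ + h ≤ heightAt h0 s x ×
    heightAt h0 s x″ + h ≤ heightAt h0 s x ×
    (∀ z → x′ < z → z < x″ → IsPeak s z →
       heightAt h0 s z ≤ heightAt h0 s x ×
       (heightAt h0 s z ≡ heightAt h0 s x → x ≤ z))

-- Between each end and x the path passes through the exact depth; moving the ends there shrinks the
-- window, so domination persists. As h is positive, the new ends differ from x.
tighten : ∀ {h0 s x h} → 1 ≤ h → RelAdmissible≤ h0 s x h → RelAdmissible h0 s x h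
tighten {h0} {s} {x} {h} 1≤h (x′ , x″ , x′<x , x<x″ , x″≤ , p , q , dom) =
  let T  = heightAt h0 s x ∸ h
      h≤ = ≤-trans (m≤n+m h (heightAt h0 s x′)) p
      hit : ∀ y → heightAt h0 s y ≡ T → heightAt h0 s y + h ≡ heightAt h0 s x
      hit y eq = trans (cong (_+ h) eq) (m∸n+n≡m h≤)
      y≢x : ∀ y → heightAt h0 s y ≡ T → y ≢ x
      y≢x y eq y≡x = m+1+n≢m (heightAt h0 s x)
        (trans (cong (heightAt h0 s x +_) (suc-pred h {{>-nonZero 1≤h}}))
          (subst (λ y → heightAt h0 s y + h ≡ heightAt h0 s x) y≡x (hit y eq)))
      y′ , l₁ , l₂ , l = height-crosses-up h0 s T (<⇒≤ x′<x) (m+n≤o⇒m≤o∸n _ p) (m∸n≤m _ h)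
      y″ , r₁ , r₂ , r = height-crosses-down h0 s T (<⇒≤ x<x″) (m∸n≤m _ h) (m+n≤o⇒m≤o∸n _ q)
  in y′ , y″ , ≤∧≢⇒< l₂ (y≢x y′ l) , ≤∧≢⇒< r₁ (λ eq → y≢x y″ r (sym eq)) , ≤-trans r₂ x″≤ , hit y′ l , hit y″ r ,
     (λ z y′<z z<y″ → dom z (≤-<-trans l₁ y′<z) (<-≤-trans z<y″ r₂))

peak-admits-1 : ∀ {h s x} → Walk h s → IsPeak s x → RelAdmissible h s x 1
peak-admits-1 {h} {s} {suc j} W pk@(up , down) =
  j , suc (suc j) , ≤-refl , ≤-refl , stepAt-< down ,
  trans (+-comm _ 1) (sym (height-NE h up)) ,
  trans (+-comm _ 1) (sym (height-SE W down)) ,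
  (λ { z j<z (s≤s z≤) _ → subst (λ z → heightAt h s z ≤ heightAt h s (suc j) × (heightAt h s z ≡ _ → suc j ≤ z))
         (≤-antisym j<z z≤) (≤-refl , (λ _ → ≤-refl)) })

admissible-≤-height : ∀ {h s x r} → RelAdmissible h s x r → r ≤ heightAt h s x
admissible-≤-height {h} {s} {x} {r} (x′ , _ , _ , _ , _ , eq , _) = subst (r ≤_) eq (m≤n+m r _)

relHeight-≥1 : ∀ {h s x r} → Walk h s → IsPeak s x → IsRelHeight h s x r → 1 ≤ r
relHeight-≥1 W pk (_ , max) = max 1 (peak-admits-1 W pk)

-- Insertion of peaks

-- A step put in front of w moves all insertions by one, which changes only the distance to the
-- first of them.
bump : List ℕ → List ℕ
bump []       = []
bump (g ∷ gs) = suc g ∷ gs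

length-bump : ∀ gs → length (bump gs) ≡ length gs
length-bump []       = refl
length-bump (g ∷ gs) = refl

-- Excludes exactly the pattern NE SE, where `keep` would compete with `summit` and the result of an
-- insertion would be ambiguous.
data NoSummit : Step → List Step → Set where
  se-  : ∀ {w} → NoSummit SE w
  e-   : ∀ {w} → NoSummit E w
  ne[] : NoSummit NE []
  nene : ∀ {w} → NoSummit NE (NE ∷ w)
  nee  : ∀ {w} → NoSummit NE (E ∷ w)

-- Ins gs w s: the path s arises from w, continued by E steps for ever, by inserting NE SE once
-- at every peak of w and once more at each of length gs vertices, not necessarily distinct; the
-- entries of gs are the distances in w between consecutive ones of these vertices.
data Ins : List ℕ → List Step → List Step → Set where
  done   : Ins [] [] []
  extra  : ∀ {gs w s} → Ins gs w s → Ins (0 ∷ gs) w (NE ∷ SE ∷ s)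
  tail   : ∀ {g gs s} → Ins (g ∷ gs) [] s → Ins (suc g ∷ gs) [] (E ∷ s)
  keep   : ∀ {gs w s} t → NoSummit t w → Ins gs w s → Ins (bump gs) (t ∷ w) (t ∷ s)
  summit : ∀ {gs w s} → Ins gs (SE ∷ w) s → Ins (bump gs) (NE ∷ SE ∷ w) (NE ∷ NE ∷ SE ∷ s)

noSummit-Ins : ∀ {gs w s t} → NoSummit t w → Ins gs w s → NoSummit t s
noSummit-Ins se-  _               = se-
noSummit-Ins e-   _               = e-
noSummit-Ins ne[] done            = ne[]
noSummit-Ins ne[] (extra D)       = nene
noSummit-Ins ne[] (tail D)        = nee
noSummit-Ins nene (extra D)       = nene
noSummit-Ins nene (keep _ _ D)    = nene
noSummit-Ins nene (summit D)      = nene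
noSummit-Ins nee  (extra D)       = nene
noSummit-Ins nee  (keep _ _ D)    = nee

raise : Step → List Step → List Step → List Step
raise NE (SE ∷ w) s = NE ∷ NE ∷ SE ∷ s
raise NE w        s = NE ∷ s
raise SE w        s = SE ∷ s
raise E  w        s = E ∷ s

uplift : List Step → List Step
uplift []      = []
uplift (t ∷ w) = raise t w (uplift w)

-- The leading distance becomes an argument of its own in `insertAfter`, which makes the recursion
-- structural beyond the end of w as well.
insert : List ℕ → List Step → List Step
insertAfter : ℕ → List ℕ → List Step → List Step
insert []       w = uplift w
insert (g ∷ gs) w = insertAfter g gs w
insertAfter zero    gs w       = NE ∷ SE ∷ insert gs w
insertAfter (suc g) gs []      = E ∷ insertAfter g gs []
insertAfter (suc g) gs (t ∷ w) = raise t w (insertAfter g gs w)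

Ins-raise : ∀ {gs w s} t → Ins gs w s → Ins (bump gs) (t ∷ w) (raise t w s)
Ins-raise {w = []}     NE D = keep NE ne[] D
Ins-raise {w = NE ∷ w} NE D = keep NE nene D
Ins-raise {w = SE ∷ w} NE D = summit D
Ins-raise {w = E ∷ w}  NE D = keep NE nee D
Ins-raise SE D = keep SE se- D
Ins-raise E  D = keep E e- D

Ins-uplift : ∀ w → Ins [] w (uplift w)
Ins-uplift []      = done
Ins-uplift (t ∷ w) = Ins-raise t (Ins-uplift w)

Ins-insert : ∀ gs w → Ins gs w (insert gs w)
Ins-insertAfter : ∀ g gs w → Ins (g ∷ gs) w (insertAfter g gs w)
Ins-insert []       w = Ins-uplift w
Ins-insert (g ∷ gs) w = Ins-insertAfter g gs w
Ins-insertAfter zero    gs w       = extra (Ins-insert gs w)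
Ins-insertAfter (suc g) gs []      = tail (Ins-insertAfter g gs [])
Ins-insertAfter (suc g) gs (t ∷ w) = Ins-raise t (Ins-insertAfter g gs w)

insert-bump : ∀ gs t w → insert (bump gs) (t ∷ w) ≡ raise t w (insert gs w)
insert-bump []       t w = refl
insert-bump (g ∷ gs) t w = refl

raise-flat : ∀ {t w} s → NoSummit t w → raise t w s ≡ t ∷ s
raise-flat s se-  = refl
raise-flat s e-   = refl
raise-flat s ne[] = refl
raise-flat s nene = refl
raise-flat s nee  = refl

Ins-functional : ∀ {gs w s} → Ins gs w s → insert gs w ≡ s
Ins-functional done      = refl
Ins-functional (extra D) = cong (λ s → NE ∷ SE ∷ s) (Ins-functional D)
Ins-functional (tail D)  = cong (E ∷_) (Ins-functional D)
Ins-functional (keep {gs} {w} t flat D) =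
  trans (insert-bump gs t w) (trans (raise-flat _ flat) (cong (t ∷_) (Ins-functional D)))
Ins-functional (summit {gs} {w} D) =
  trans (insert-bump gs NE (SE ∷ w)) (cong (λ s → NE ∷ NE ∷ SE ∷ s) (Ins-functional D))

-- Recovering the insertions from the path

NoFinalE : List Step → Set
NoFinalE []          = ⊤
NoFinalE (NE ∷ s)    = NoFinalE s
NoFinalE (SE ∷ s)    = NoFinalE s
NoFinalE (E ∷ [])    = ⊥
NoFinalE (E ∷ t ∷ s) = NoFinalE (t ∷ s)

-- An NE step in front of an SE step to be copied from w is the inserted NE SE of an extra peak;
-- in front of an inserted NE SE that precedes such an SE step, it makes that one the peak of w.
push : Step → List ℕ × List Step → List ℕ × List Step
push NE (gs , [])             = bump gs , NE ∷ []
push NE (gs , NE ∷ w)         = bump gs , NE ∷ NE ∷ w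
push NE (gs , E ∷ w)          = bump gs , NE ∷ E ∷ w
push NE ([]         , SE ∷ w) = 0 ∷ [] , w
push NE (zero  ∷ gs , SE ∷ w) = bump gs , NE ∷ SE ∷ w
push NE (suc g ∷ gs , SE ∷ w) = 0 ∷ g ∷ gs , w
push SE (gs , w)              = bump gs , SE ∷ w
push E  (gs , [])             = bump gs , []
push E  (gs , t ∷ w)          = bump gs , E ∷ t ∷ w

parse : List Step → List ℕ × List Step
parse = foldr push ([] , [])

-- An E step in front of an empty w is ascribed to the infinite continuation and never copied. This
-- normalises w and makes it unique.
parse-noFinalE : ∀ s → NoFinalE (proj₂ (parse s))
parse-noFinalE [] = tt
parse-noFinalE (t ∷ s) = push-noFinalE t (parse s) (parse-noFinalE s)
  where
  push-noFinalE : ∀ t p → NoFinalE (proj₂ p) → NoFinalE (proj₂ (push t p))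
  push-noFinalE NE ([]         , SE ∷ w) ok = ok
  push-noFinalE NE (zero  ∷ gs , SE ∷ w) ok = ok
  push-noFinalE NE (suc g ∷ gs , SE ∷ w) ok = ok
  push-noFinalE NE (gs , [])             ok = ok
  push-noFinalE NE (gs , NE ∷ w)         ok = ok
  push-noFinalE NE (gs , E ∷ w)          ok = ok
  push-noFinalE SE (gs , w)              ok = ok
  push-noFinalE E  (gs , [])             ok = ok
  push-noFinalE E  (gs , t ∷ w)          ok = ok

push-flat : ∀ {t w} gs → NoSummit t w → NoFinalE (t ∷ w) → push t (gs , w) ≡ (bump gs , t ∷ w)
push-flat gs se- _ = refl
push-flat {w = t ∷ w} gs e- _ = refl
push-flat gs ne[] _ = refl
push-flat gs nene _ = refl
push-flat gs nee _ = refl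

-- `push SE` treats the step as copied from w and increases the first distance; the NE step in front
-- of it reveals an inserted pair, and the increase is taken back.
push-NE-SE : ∀ gs w → push NE (push SE (gs , w)) ≡ (0 ∷ gs , w)
push-NE-SE []       w = refl
push-NE-SE (g ∷ gs) w = refl

noFinalE-tail : ∀ t {s} → NoFinalE (t ∷ s) → NoFinalE s
noFinalE-tail NE ok = ok
noFinalE-tail SE ok = ok
noFinalE-tail E {[]}    ok = tt
noFinalE-tail E {t ∷ s} ok = ok

parse-Ins : ∀ {gs w s} → Ins gs w s → NoFinalE w → parse s ≡ (gs , w)
parse-Ins done _ = refl
parse-Ins (extra {gs} {w} D) ok = trans (cong (λ p → push NE (push SE p)) (parse-Ins D ok)) (push-NE-SE gs w)
parse-Ins (tail D) ok = cong (push E) (parse-Ins D ok)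
parse-Ins (keep {gs} t flat D) ok =
  trans (cong (push t) (parse-Ins D (noFinalE-tail t ok))) (push-flat gs flat ok)
parse-Ins (summit {gs} {w} D) ok =
  cong (push NE) (trans (cong (λ p → push NE (push SE p)) (parse-Ins D ok)) (push-NE-SE gs (SE ∷ w)))

-- For NE in front of an SE step of w, the derivation tells whether s begins with an inserted NE SE,
-- so that a summit arises, or with that SE step itself, so that an extra peak does. An E step that
-- ends the path is the one case without a derivation.
Ins-push : ∀ t {gs w s} → NoFinalE (t ∷ s) → Ins gs w s →
  Ins (proj₁ (push t (gs , w))) (proj₂ (push t (gs , w))) (t ∷ s)
Ins-push NE {w = []}     _ D = keep NE ne[] D
Ins-push NE {w = NE ∷ w} _ D = keep NE nene D
Ins-push NE {w = E ∷ w}  _ D = keep NE nee D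
Ins-push NE {w = SE ∷ w} _ (extra D) = summit D
Ins-push NE {w = SE ∷ w} _ (keep {[]} _ _ D) = extra D
Ins-push NE {w = SE ∷ w} _ (keep {_ ∷ _} _ _ D) = extra D
Ins-push SE _ D = keep SE se- D
Ins-push E {w = t ∷ w} _ D = keep E e- D
Ins-push E {_ ∷ _} {[]} _ D = tail D
Ins-push E {[]} {[]} () done

Ins-parse : ∀ s → NoFinalE s → Ins (proj₁ (parse s)) (proj₂ (parse s)) s
Ins-parse []      _  = done
Ins-parse (t ∷ s) ok = Ins-push t ok (Ins-parse s (noFinalE-tail t ok))

noFinalE-Ins : ∀ {gs w s} → Ins gs w s → NoFinalE w → NoFinalE s
noFinalE-Ins done ok = tt
noFinalE-Ins (extra D) ok = noFinalE-Ins D ok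
noFinalE-Ins (tail {s = []} ()) ok
noFinalE-Ins (tail {s = t ∷ s} D) ok = noFinalE-Ins D ok
noFinalE-Ins (keep NE _ D) ok = noFinalE-Ins D ok
noFinalE-Ins (keep SE _ D) ok = noFinalE-Ins D ok
noFinalE-Ins (keep {w = t ∷ w} {[]} E _ ()) ok
noFinalE-Ins (keep {w = t ∷ w} {u ∷ s} E _ D) ok = noFinalE-Ins D ok
noFinalE-Ins (summit D) ok = noFinalE-Ins D ok

endsWell⇒noFinalE : ∀ {s} → EndsWell s → NoFinalE s
endsWell⇒noFinalE (inj₁ refl) = tt
endsWell⇒noFinalE (inj₂ (t , refl)) = snoc t
  where
  snoc : ∀ t → NoFinalE (t ++ SE ∷ [])
  snoc []           = tt
  snoc (NE ∷ t)     = snoc t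
  snoc (SE ∷ t)     = snoc t
  snoc (E ∷ [])     = tt
  snoc (E ∷ u ∷ t)  = snoc (u ∷ t)

noFinalE⇒endsWell : ∀ {h s} → Walk h s → NoFinalE s → EndsWell s
noFinalE⇒endsWell stop _ = inj₁ refl
noFinalE⇒endsWell (ne w) ok with noFinalE⇒endsWell w ok
noFinalE⇒endsWell (ne ()) ok | inj₁ refl
... | inj₂ (t , refl) = inj₂ (NE ∷ t , refl)
noFinalE⇒endsWell (se w) ok with noFinalE⇒endsWell w ok
... | inj₁ refl = inj₂ ([] , refl)
... | inj₂ (t , refl) = inj₂ (SE ∷ t , refl)
noFinalE⇒endsWell {s = E ∷ _ ∷ _} (e w) ok with noFinalE⇒endsWell w ok
... | inj₂ (t , eq) = inj₂ (E ∷ t , cong (E ∷_) eq)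

walk-Ins : ∀ {h gs w s} → Ins gs w s → Walk h w → Walk h s
walk-Ins done W = W
walk-Ins (extra D) W = ne (se (walk-Ins D W))
walk-Ins (tail D) stop = e (walk-Ins D stop)
walk-Ins (keep _ _ D) (ne W) = ne (walk-Ins D W)
walk-Ins (keep _ _ D) (se W) = se (walk-Ins D W)
walk-Ins (keep _ _ D) (e W) = e (walk-Ins D W)
walk-Ins (summit D) (ne W) = ne (ne (se (walk-Ins D W)))

walk-Ins⁻ : ∀ {h gs w s} → Ins gs w s → Walk h s → Walk h w
walk-Ins⁻ done W = W
walk-Ins⁻ (extra D) (ne (se W)) = walk-Ins⁻ D W
walk-Ins⁻ (tail D) (e W) = walk-Ins⁻ D W
walk-Ins⁻ (keep _ _ D) (ne W) = ne (walk-Ins⁻ D W)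
walk-Ins⁻ (keep _ _ D) (se W) = se (walk-Ins⁻ D W)
walk-Ins⁻ (keep _ _ D) (e W) = e (walk-Ins⁻ D W)
walk-Ins⁻ (summit D) (ne (ne (se W))) = ne (walk-Ins⁻ D W)

-- The major index under insertion

peaks : List Step → ℕ
peaks (NE ∷ SE ∷ s) = suc (peaks (SE ∷ s))
peaks (_ ∷ s)       = peaks s
peaks []            = 0

peaks-flat : ∀ {t s} → NoSummit t s → peaks (t ∷ s) ≡ peaks s
peaks-flat se-  = refl
peaks-flat e-   = refl
peaks-flat ne[] = refl
peaks-flat nene = refl
peaks-flat nee  = refl

majorFrom-flat : ∀ {t s} i → NoSummit t s → majorFrom i (t ∷ s) ≡ majorFrom (suc i) s
majorFrom-flat i se-  = refl
majorFrom-flat i e-   = refl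
majorFrom-flat i ne[] = refl
majorFrom-flat i nene = refl
majorFrom-flat i nee  = refl

noSummit? : ∀ t s → NoSummit t s ⊎ (t ≡ NE × ∃ λ s′ → s ≡ SE ∷ s′)
noSummit? NE []       = inj₁ ne[]
noSummit? NE (NE ∷ s) = inj₁ nene
noSummit? NE (SE ∷ s) = inj₂ (refl , s , refl)
noSummit? NE (E ∷ s)  = inj₁ nee
noSummit? SE s        = inj₁ se-
noSummit? E  s        = inj₁ e-

majorFrom-shift : ∀ d i s → majorFrom (d + i) s ≡ majorFrom i s + d * peaks s
majorFrom-shift d i [] = sym (*-zeroʳ d)
majorFrom-shift d i (t ∷ s) with noSummit? t s
... | inj₁ flat = begin
  majorFrom (d + i) (t ∷ s)        ≡⟨ majorFrom-flat (d + i) flat ⟩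
  majorFrom (suc (d + i)) s        ≡⟨ cong (λ j → majorFrom j s) (sym (+-suc d i)) ⟩
  majorFrom (d + suc i) s          ≡⟨ majorFrom-shift d (suc i) s ⟩
  majorFrom (suc i) s + d * peaks s ≡⟨ cong₂ (λ a b → a + d * b) (sym (majorFrom-flat i flat)) (sym (peaks-flat flat)) ⟩
  majorFrom i (t ∷ s) + d * peaks (t ∷ s) ∎
  where open ≡-Reasoning
... | inj₂ (refl , s′ , refl) = begin
  suc (d + i) + majorFrom (suc (d + i)) s
    ≡⟨ cong (λ j → suc (d + i) + majorFrom j s) (sym (+-suc d i)) ⟩
  suc (d + i) + majorFrom (d + suc i) s
    ≡⟨ cong (suc (d + i) +_) (majorFrom-shift d (suc i) s) ⟩
  suc (d + i) + (majorFrom (suc i) s + d * peaks s)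
    ≡⟨ solve 4 (λ d i m p → con 1 :+ (d :+ i) :+ (m :+ d :* p) := con 1 :+ i :+ m :+ d :* (con 1 :+ p))
         refl d i (majorFrom (suc i) s) (peaks s) ⟩
  suc i + majorFrom (suc i) s + d * suc (peaks s) ∎
  where
  open ≡-Reasoning
  open +-*-Solver

major-shift : ∀ d s → majorFrom d s ≡ majorIndex s + d * peaks s
major-shift d s = trans (cong (λ j → majorFrom j s) (sym (+-identityʳ d))) (majorFrom-shift d 0 s)

-- The sum of the abscissae in w of the extra insertions: a distance g is part of the abscissa of
-- its own insertion and of every later one.
gapWeight : List ℕ → ℕ
gapWeight []       = 0
gapWeight (g ∷ gs) = suc (length gs) * g + gapWeight gs

gapWeight-bump : ∀ gs → gapWeight (bump gs) ≡ gapWeight gs + length gs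
gapWeight-bump []       = refl
gapWeight-bump (g ∷ gs) =
  solve 3 (λ l g r → (con 1 :+ l) :* (con 1 :+ g) :+ r := (con 1 :+ l) :* g :+ r :+ (con 1 :+ l))
    refl (length gs) g (gapWeight gs)
  where open +-*-Solver

peaks-Ins : ∀ {gs w s} → Ins gs w s → peaks s ≡ length gs + peaks w
peaks-Ins done = refl
peaks-Ins (extra D) = cong suc (peaks-Ins D)
peaks-Ins (tail D) = peaks-Ins D
peaks-Ins (keep {gs} t flat D) =
  trans (peaks-flat (noSummit-Ins flat D))
    (trans (peaks-Ins D) (cong₂ _+_ (sym (length-bump gs)) (sym (peaks-flat flat))))
peaks-Ins (summit {gs} D) =
  trans (cong suc (peaks-Ins D)) (trans (sym (+-suc _ _)) (cong (_+ _) (sym (length-bump gs))))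

-- An extra NE SE in front of a path with n peaks adds a peak at 1 and moves the others by 2, and 1
-- + 2 n is the difference of consecutive squares. A copied step moves all peaks by 1: for the
-- raised ones this is the growth of the major index of w, for the extra ones that of `gapWeight`. A
-- summit combines both.
major-Ins : ∀ {gs w s} → Ins gs w s →
  majorIndex s ≡ (length gs + peaks w) * (length gs + peaks w) + majorIndex w + gapWeight gs
major-Ins done = refl
major-Ins (extra {gs} {w} {s} D) = begin
  1 + majorFrom 2 s
    ≡⟨ cong suc (major-shift 2 s) ⟩
  1 + (majorIndex s + 2 * peaks s)
    ≡⟨ cong₂ (λ m p → 1 + (m + 2 * p)) (major-Ins D) (peaks-Ins D) ⟩
  1 + (n * n + majorIndex w + gapWeight gs + 2 * n)
    ≡⟨ solve 4 (λ l n m g → con 1 :+ (n :* n :+ m :+ g :+ con 2 :* n)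
                := (con 1 :+ n) :* (con 1 :+ n) :+ m :+ ((con 1 :+ l) :* con 0 :+ g))
         refl (length gs) n (majorIndex w) (gapWeight gs) ⟩
  suc n * suc n + majorIndex w + gapWeight (0 ∷ gs) ∎
  where
  open ≡-Reasoning
  open +-*-Solver
  n = length gs + peaks w
major-Ins (tail {g} {gs} {s} D) = begin
  majorFrom 1 s
    ≡⟨ major-shift 1 s ⟩
  majorIndex s + 1 * peaks s
    ≡⟨ cong₂ (λ m p → m + 1 * p) (major-Ins D) (peaks-Ins D) ⟩
  (suc (length gs) + 0) * (suc (length gs) + 0) + 0 + gapWeight (g ∷ gs) + 1 * (suc (length gs) + 0)
    ≡⟨ solve 3 (λ l g r → (con 1 :+ l :+ con 0) :* (con 1 :+ l :+ con 0) :+ con 0 :+ ((con 1 :+ l) :* g :+ r)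
                  :+ con 1 :* (con 1 :+ l :+ con 0)
                := (con 1 :+ l :+ con 0) :* (con 1 :+ l :+ con 0) :+ con 0 :+ ((con 1 :+ l) :* (con 1 :+ g) :+ r))
         refl (length gs) g (gapWeight gs) ⟩
  (suc (length gs) + 0) * (suc (length gs) + 0) + 0 + gapWeight (suc g ∷ gs) ∎
  where
  open ≡-Reasoning
  open +-*-Solver
major-Ins (keep {gs} {w} {s} t flat D) = begin
  majorFrom 0 (t ∷ s)
    ≡⟨ trans (majorFrom-flat 0 (noSummit-Ins flat D)) (major-shift 1 s) ⟩
  majorIndex s + 1 * peaks s
    ≡⟨ cong₂ (λ m p → m + 1 * p) (major-Ins D) (peaks-Ins D) ⟩
  n * n + majorIndex w + gapWeight gs + 1 * n
    ≡⟨ solve 4 (λ l p m g → (l :+ p) :* (l :+ p) :+ m :+ g :+ con 1 :* (l :+ p)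
                := (l :+ p) :* (l :+ p) :+ (m :+ con 1 :* p) :+ (g :+ l))
         refl (length gs) (peaks w) (majorIndex w) (gapWeight gs) ⟩
  n * n + (majorIndex w + 1 * peaks w) + (gapWeight gs + length gs)
    ≡⟨ cong₂ (λ m g → n * n + m + g)
         (sym (trans (majorFrom-flat 0 flat) (major-shift 1 w))) (sym (gapWeight-bump gs)) ⟩
  n * n + majorIndex (t ∷ w) + gapWeight (bump gs)
    ≡⟨ cong (λ n → n * n + majorIndex (t ∷ w) + gapWeight (bump gs))
         (cong₂ _+_ (sym (length-bump gs)) (sym (peaks-flat flat))) ⟩
  n′ * n′ + majorIndex (t ∷ w) + gapWeight (bump gs) ∎
  where
  open ≡-Reasoning
  open +-*-Solver
  n = length gs + peaks w
  n′ = length (bump gs) + peaks (t ∷ w)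
major-Ins (summit {gs} {w} {s} D) = begin
  2 + majorFrom 3 s
    ≡⟨ cong (2 +_) (major-shift 3 s) ⟩
  2 + (majorIndex s + 3 * peaks s)
    ≡⟨ cong₂ (λ m p → 2 + (m + 3 * p)) (major-Ins D) (peaks-Ins D) ⟩
  2 + ((l + p) * (l + p) + m + gapWeight gs + 3 * (l + p))
    ≡⟨ solve 4 (λ l p m g → con 2 :+ ((l :+ p) :* (l :+ p) :+ m :+ g :+ con 3 :* (l :+ p))
                := (l :+ (con 1 :+ p)) :* (l :+ (con 1 :+ p)) :+ (con 1 :+ (m :+ con 1 :* p)) :+ (g :+ l))
         refl l p m (gapWeight gs) ⟩
  (l + suc p) * (l + suc p) + (1 + (m + 1 * p)) + (gapWeight gs + l)
    ≡⟨ cong₂ (λ m g → (l + suc p) * (l + suc p) + (1 + m) + g)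
         (sym (major-shift 1 (SE ∷ w))) (sym (gapWeight-bump gs)) ⟩
  (l + suc p) * (l + suc p) + majorIndex (NE ∷ SE ∷ w) + gapWeight (bump gs)
    ≡⟨ cong (λ l → (l + suc p) * (l + suc p) + majorIndex (NE ∷ SE ∷ w) + gapWeight (bump gs))
         (sym (length-bump gs)) ⟩
  (l′ + suc p) * (l′ + suc p) + majorIndex (NE ∷ SE ∷ w) + gapWeight (bump gs) ∎
  where
  open ≡-Reasoning
  open +-*-Solver
  l = length gs
  l′ = length (bump gs)
  p = peaks (SE ∷ w)
  m = majorIndex (SE ∷ w)

-- Relative heights under insertion

-- The vertex of w that a vertex of s copies or is inserted at. Heights in s and w agree along π,
-- except that the peaks of s are higher by one.
π : ∀ {gs w s} → Ins gs w s → ℕ → ℕ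
π done          v                   = 0
π (extra D)     zero                = 0
π (extra D)     (suc zero)          = 0
π (extra D)     (suc (suc v))       = π D v
π (tail D)      zero                = 0
π (tail D)      (suc v)             = π D v
π (keep t _ D)  zero                = 0
π (keep t _ D)  (suc v)             = suc (π D v)
π (summit D)    zero                = 0
π (summit D)    (suc zero)          = 1
π (summit D)    (suc (suc zero))    = 1
π (summit D)    (suc (suc (suc v))) = suc (π D v)

π-zero : ∀ {gs w s} (D : Ins gs w s) → π D 0 ≡ 0
π-zero done         = refl
π-zero (extra D)    = refl
π-zero (tail D)     = refl
π-zero (keep _ _ D) = refl
π-zero (summit D)   = refl

π-suc : ∀ {gs w s} (D : Ins gs w s) v → π D v ≤ π D (suc v)
π-suc done          v                   = z≤n
π-suc (extra D)     zero                = z≤n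
π-suc (extra D)     (suc zero)          = z≤n
π-suc (extra D)     (suc (suc v))       = π-suc D v
π-suc (tail D)      zero                = z≤n
π-suc (tail D)      (suc v)             = π-suc D v
π-suc (keep t _ D)  zero                = z≤n
π-suc (keep t _ D)  (suc v)             = s≤s (π-suc D v)
π-suc (summit D)    zero                = z≤n
π-suc (summit D)    (suc zero)          = ≤-refl
π-suc (summit D)    (suc (suc zero))    = s≤s z≤n
π-suc (summit D)    (suc (suc (suc v))) = s≤s (π-suc D v)

π-mono : ∀ {gs w s} (D : Ins gs w s) {u v} → u ≤ v → π D u ≤ π D v
π-mono D u≤v = go (≤⇒≤′ u≤v)
  where
  go : ∀ {u v} → u ≤′ v → π D u ≤ π D v
  go ≤′-refl        = ≤-refl
  go (≤′-step u≤′v) = ≤-trans (go u≤′v) (π-suc D _)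

π-reflects-< : ∀ {gs w s} (D : Ins gs w s) {u v} → π D u < π D v → u < v
π-reflects-< D πu<πv = ≰⇒> (λ v≤u → <⇒≱ πu<πv (π-mono D v≤u))

π-≤length : ∀ {gs w s} (D : Ins gs w s) v → π D v ≤ length w
π-≤length done          v                   = z≤n
π-≤length (extra D)     zero                = z≤n
π-≤length (extra D)     (suc zero)          = z≤n
π-≤length (extra D)     (suc (suc v))       = π-≤length D v
π-≤length (tail D)      zero                = z≤n
π-≤length (tail D)      (suc v)             = π-≤length D v
π-≤length (keep t _ D)  zero                = z≤n
π-≤length (keep t _ D)  (suc v)             = s≤s (π-≤length D v)
π-≤length (summit D)    zero                = z≤n
π-≤length (summit D)    (suc zero)          = s≤s z≤n
π-≤length (summit D)    (suc (suc zero))    = s≤s z≤n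
π-≤length (summit D)    (suc (suc (suc v))) = s≤s (π-≤length D v)

height-π : ∀ {gs w s} (D : Ins gs w s) h v →
  heightAt h w (π D v) ≤ heightAt h s v × heightAt h s v ≤ suc (heightAt h w (π D v))
height-π done          h zero                = ≤-refl , n≤1+n _
height-π done          h (suc v)             = ≤-refl , n≤1+n _
height-π (extra D)     h zero                = ≤-refl , n≤1+n _
height-π (extra D)     h (suc zero)          = n≤1+n _ , ≤-refl
height-π (extra D)     h (suc (suc v))       = height-π D h v
height-π (tail D)      h zero                = ≤-refl , n≤1+n _
height-π (tail D)      h (suc v)             = height-π D h v
height-π (keep t _ D)  h zero                = ≤-refl , n≤1+n _
height-π (keep NE _ D) h (suc v)             = height-π D (suc h) v
height-π (keep SE _ D) h (suc v)             = height-π D (h ∸ 1) v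
height-π (keep E _ D)  h (suc v)             = height-π D h v
height-π (summit D)    h zero                = ≤-refl , n≤1+n _
height-π (summit D)    h (suc zero)          = ≤-refl , n≤1+n _
height-π (summit D)    h (suc (suc zero))    = n≤1+n _ , ≤-refl
height-π (summit D)    h (suc (suc (suc v))) = height-π D (suc h) v

-- Over every vertex of w lies one that is not an inserted peak, so the ends of a window in w lift
-- with their exact heights.
π-section : ∀ {gs w s} (D : Ins gs w s) h x → x ≤ length w →
  ∃ λ v → v ≤ length s × π D v ≡ x × heightAt h s v ≡ heightAt h w x
π-section D h zero _ = 0 , z≤n , π-zero D , refl
π-section (extra D) h (suc x) x≤ =
  let v , v≤ , eq , ht = π-section D h (suc x) x≤ in suc (suc v) , s≤s (s≤s v≤) , eq , ht
π-section (keep NE _ D) h (suc x) (s≤s x≤) =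
  let v , v≤ , eq , ht = π-section D (suc h) x x≤ in suc v , s≤s v≤ , cong suc eq , ht
π-section (keep SE _ D) h (suc x) (s≤s x≤) =
  let v , v≤ , eq , ht = π-section D (h ∸ 1) x x≤ in suc v , s≤s v≤ , cong suc eq , ht
π-section (keep E _ D) h (suc x) (s≤s x≤) =
  let v , v≤ , eq , ht = π-section D h x x≤ in suc v , s≤s v≤ , cong suc eq , ht
π-section (summit D) h (suc x) (s≤s x≤) =
  let v , v≤ , eq , ht = π-section D (suc h) x x≤ in suc (suc (suc v)) , s≤s (s≤s (s≤s v≤)) , cong suc eq , ht

noSummit-not-peak : ∀ {t s} → NoSummit t s → ¬ IsPeak (t ∷ s) 1
noSummit-not-peak se-  (() , _)
noSummit-not-peak e-   (() , _)
noSummit-not-peak ne[] (_ , there ())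
noSummit-not-peak nene (_ , there ())
noSummit-not-peak nee  (_ , there ())

peak-tail : ∀ {t s j} → IsPeak (t ∷ s) (suc (suc j)) → IsPeak s (suc j)
peak-tail (there up , there down) = up , down

peak-cons : ∀ {t s x} → IsPeak s x → IsPeak (t ∷ s) (suc x)
peak-cons {x = suc x} (up , down) = there up , there down

-- Raised D x X: the peak X of s is the first one inserted at the peak x of w; the other peaks
-- of s are Extra.
data Extra : ∀ {gs w s} → Ins gs w s → ℕ → Set where
  here   : ∀ {gs w s} {D : Ins gs w s} → Extra (extra D) 1
  extra  : ∀ {gs w s X} {D : Ins gs w s} → Extra D X → Extra (extra D) (2 + X)
  tail   : ∀ {g gs s X} {D : Ins (g ∷ gs) [] s} → Extra D X → Extra (tail D) (suc X)
  keep   : ∀ {gs w s X t flat} {D : Ins gs w s} → Extra D X → Extra (keep t flat D) (suc X)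
  summit : ∀ {gs w s X} {D : Ins gs (SE ∷ w) s} → Extra D X → Extra (summit D) (3 + X)

data Raised : ∀ {gs w s} → Ins gs w s → ℕ → ℕ → Set where
  here   : ∀ {gs w s} {D : Ins gs (SE ∷ w) s} → Raised (summit D) 1 2
  extra  : ∀ {gs w s x X} {D : Ins gs w s} → Raised D x X → Raised (extra D) x (2 + X)
  keep   : ∀ {gs w s x X t flat} {D : Ins gs w s} → Raised D x X → Raised (keep t flat D) (suc x) (suc X)
  summit : ∀ {gs w s x X} {D : Ins gs (SE ∷ w) s} → Raised D x X → Raised (summit D) (suc x) (3 + X)

raised-[] : ∀ {gs s x X} {D : Ins gs [] s} → ¬ Raised D x X
raised-[] (extra R) = raised-[] R

classify : ∀ {gs w s} (D : Ins gs w s) X → IsPeak s X → Extra D X ⊎ ∃ λ x → Raised D x X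
classify done (suc X) (() , _)
classify (extra D) (suc zero) pk = inj₁ here
classify (extra D) (suc (suc zero)) (there () , _)
classify (extra D) (suc (suc (suc X))) pk =
  Sum.map extra (λ { (x , R) → x , extra R }) (classify D (suc X) (peak-tail (peak-tail pk)))
classify (tail D) (suc zero) (() , _)
classify (tail D) (suc (suc X)) pk =
  Sum.map tail (λ { (x , R) → ⊥-elim (raised-[] R) }) (classify D (suc X) (peak-tail pk))
classify (keep t flat D) (suc zero) pk = ⊥-elim (noSummit-not-peak (noSummit-Ins flat D) pk)
classify (keep t flat D) (suc (suc X)) pk =
  Sum.map keep (λ { (x , R) → suc x , keep R }) (classify D (suc X) (peak-tail pk))
classify (summit D) (suc zero) (_ , there ())
classify (summit D) (suc (suc zero)) pk = inj₂ (1 , here)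
classify (summit D) (suc (suc (suc zero))) (there (there ()) , _)
classify (summit D) (suc (suc (suc (suc X)))) pk =
  Sum.map summit (λ { (x , R) → suc x , summit R }) (classify D (suc X) (peak-tail (peak-tail (peak-tail pk))))

raise-peak : ∀ {gs w s} (D : Ins gs w s) x → IsPeak w x → ∃ (Raised D x)
raise-peak (extra D) x pk = let X , R = raise-peak D x pk in 2 + X , extra R
raise-peak (tail D) (suc x) (() , _)
raise-peak done (suc x) (() , _)
raise-peak (keep t flat D) (suc zero) pk = ⊥-elim (noSummit-not-peak flat pk)
raise-peak (keep t flat D) (suc (suc x)) pk =
  let X , R = raise-peak D (suc x) (peak-tail pk) in suc X , keep R
raise-peak (summit D) (suc zero) pk = 2 , here
raise-peak (summit D) (suc (suc x)) pk =
  let X , R = raise-peak D (suc x) (peak-tail pk) in 3 + X , summit R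

extra-peak : ∀ {gs w s X} {D : Ins gs w s} → Extra D X → IsPeak s X
extra-peak here       = here , there here
extra-peak (extra x)  = peak-cons (peak-cons (extra-peak x))
extra-peak (tail x)   = peak-cons (extra-peak x)
extra-peak (keep x)   = peak-cons (extra-peak x)
extra-peak (summit x) = peak-cons (peak-cons (peak-cons (extra-peak x)))

raised-peak : ∀ {gs w s x X} {D : Ins gs w s} → Raised D x X → IsPeak s X
raised-peak here       = there here , there (there here)
raised-peak (extra r)  = peak-cons (peak-cons (raised-peak r))
raised-peak (keep r)   = peak-cons (raised-peak r)
raised-peak (summit r) = peak-cons (peak-cons (peak-cons (raised-peak r)))

raised-base : ∀ {gs w s x X} {D : Ins gs w s} → Raised D x X → IsPeak w x
raised-base here       = here , there here
raised-base (extra r)  = raised-base r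
raised-base (keep r)   = peak-cons (raised-base r)
raised-base (summit r) = peak-cons (raised-base r)

π-raised : ∀ {gs w s x X} {D : Ins gs w s} → Raised D x X → π D X ≡ x
π-raised here       = refl
π-raised (extra r)  = π-raised r
π-raised (keep r)   = cong suc (π-raised r)
π-raised (summit r) = cong suc (π-raised r)

raised-not-extra : ∀ {gs w s x X} {D : Ins gs w s} → Raised D x X → ¬ Extra D X
raised-not-extra (extra r)  (extra x)  = raised-not-extra r x
raised-not-extra (keep r)   (keep x)   = raised-not-extra r x
raised-not-extra (summit r) (summit x) = raised-not-extra r x

-- In `summit` the inserted pair precedes whatever else is inserted at the same vertex. The raised
-- peak is thus the one that the tie rule favours.
raised-first : ∀ {gs w s x X} {D : Ins gs w s} → Raised D x X →
  ∀ Z → IsPeak s Z → π D Z ≡ x → X ≤ Z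
raised-first here (suc zero) (_ , there ()) eq
raised-first here (suc (suc Z)) pk eq = s≤s (s≤s z≤n)
raised-first (extra r) (suc zero) pk refl = ⊥-elim (raised-base r)
raised-first (extra r) (suc (suc zero)) (there () , _) eq
raised-first (extra r) (suc (suc (suc Z))) pk eq =
  s≤s (s≤s (raised-first r (suc Z) (peak-tail (peak-tail pk)) eq))
raised-first {D = keep t flat D} (keep r) (suc zero) pk eq
  with refl ← trans (sym (π-zero D)) (suc-injective eq) = ⊥-elim (raised-base r)
raised-first (keep r) (suc (suc Z)) pk eq =
  s≤s (raised-first r (suc Z) (peak-tail pk) (suc-injective eq))
raised-first (summit r) (suc zero) pk refl = ⊥-elim (raised-base r)
raised-first (summit r) (suc (suc zero)) pk refl = ⊥-elim (raised-base r)
raised-first (summit r) (suc (suc (suc zero))) (there (there ()) , _) eq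
raised-first (summit r) (suc (suc (suc (suc Z)))) pk eq =
  s≤s (s≤s (s≤s (raised-first r (suc Z) (peak-tail (peak-tail (peak-tail pk))) (suc-injective eq))))

height-extra : ∀ {gs w s X} {D : Ins gs w s} h → Extra D X → heightAt h s X ≡ suc (heightAt h w (π D X))
height-extra h here = refl
height-extra h (extra x) = height-extra h x
height-extra h (tail x) = height-extra h x
height-extra h (keep {t = NE} x) = height-extra (suc h) x
height-extra h (keep {t = SE} x) = height-extra (h ∸ 1) x
height-extra h (keep {t = E} x) = height-extra h x
height-extra h (summit x) = height-extra (suc h) x

height-raised : ∀ {gs w s x X} {D : Ins gs w s} h → Raised D x X → heightAt h s X ≡ suc (heightAt h w x)
height-raised h here = refl
height-raised h (extra r) = height-raised h r
height-raised h (keep {t = NE} r) = height-raised (suc h) r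
height-raised h (keep {t = SE} r) = height-raised (h ∸ 1) r
height-raised h (keep {t = E} r) = height-raised h r
height-raised h (summit r) = height-raised (suc h) r

-- Inserted pairs contain no E, and the E steps of `tail` lie beyond the end of w, behind all raised
-- peaks.
countE-raised : ∀ {gs w s x X} {D : Ins gs w s} → Raised D x X → countE (take X s) ≡ countE (take x w)
countE-raised here = refl
countE-raised (extra r) = countE-raised r
countE-raised (keep {t = NE} r) = countE-raised r
countE-raised (keep {t = SE} r) = countE-raised r
countE-raised (keep {t = E} r) = cong suc (countE-raised r)
countE-raised (summit r) = countE-raised r

height-peak-π : ∀ {gs w s} (D : Ins gs w s) h X → IsPeak s X → heightAt h s X ≡ suc (heightAt h w (π D X))
height-peak-π {w = w} D h X pk with classify D X pk
... | inj₁ x       = height-extra h x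
... | inj₂ (_ , r) = trans (height-raised h r) (cong (λ y → suc (heightAt h w y)) (sym (π-raised r)))

suc-≤-cancel : ∀ {a b r} → a + suc r ≤ suc b → a + r ≤ b
suc-≤-cancel {a} {b} {r} p = ≤-pred (subst (_≤ suc b) (+-suc a r) p)

-- The lifted window keeps its ends while its peak gains one. Every peak of s lies exactly one above
-- its vertex in w, so it suffices to bound the vertices of w.
admissible-raised : ∀ {h gs w s x X r} {D : Ins gs w s} → Walk h w → Raised D x X → 1 ≤ r →
  RelAdmissible h w x r → RelAdmissible h s X (suc r)
admissible-raised {h} {w = w} {s} {x} {X} {r} {D} W R 1≤r (x′ , x″ , x′<x , x<x″ , x″≤ , p , q , dom) =
  let v′ , _   , πv′ , hv′ = π-section D h x′ (≤-trans (<⇒≤ (<-trans x′<x x<x″)) x″≤)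
      v″ , v″≤ , πv″ , hv″ = π-section D h x″ x″≤
  in v′ , v″ ,
     π-reflects-< D (subst₂ _<_ (sym πv′) (sym (π-raised R)) x′<x) ,
     π-reflects-< D (subst₂ _<_ (sym (π-raised R)) (sym πv″) x<x″) ,
     v″≤ ,
     trans (+-suc _ r) (trans (cong suc (trans (cong (_+ r) hv′) p)) (sym (height-raised h R))) ,
     trans (+-suc _ r) (trans (cong suc (trans (cong (_+ r) hv″) q)) (sym (height-raised h R))) ,
     dominated v′ v″ πv′ πv″
  where
  low : ∀ y → heightAt h w y + r ≡ heightAt h w x → heightAt h w y < heightAt h w x
  low y eq = subst (suc (heightAt h w y) ≤_) eq (subst (_≤ heightAt h w y + r) (+-comm _ 1) (+-monoʳ-≤ _ 1≤r))

  -- Extra peaks sit over arbitrary vertices, the ends of the window included, so the bound is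
  -- needed at all of them and not only at the peaks of w.
  below : ∀ z → x′ ≤ z → z ≤ x″ → heightAt h w z < heightAt h w x ⊎ (heightAt h w z ≡ heightAt h w x × x ≤ z)
  below z x′≤z z≤x″ with m≤n⇒m<n∨m≡n x′≤z | m≤n⇒m<n∨m≡n z≤x″
  ... | inj₂ refl  | _         = inj₁ (low x′ p)
  ... | inj₁ _     | inj₂ refl = inj₁ (low x″ q)
  ... | inj₁ x′<z  | inj₁ z<x″ with heightAt h w z <? heightAt h w x
  ...   | yes lt = inj₁ lt
  ...   | no ≮ with climb W x′<z z<x″ x″≤ (<-≤-trans (low x′ p) (≮⇒≥ ≮)) (<-≤-trans (low x″ q) (≮⇒≥ ≮))
  ...     | inj₁ pk = let le , tie = dom z x′<z z<x″ pk
                          eq = ≤-antisym le (≮⇒≥ ≮)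
                      in inj₂ (eq , tie eq)
  ...     | inj₂ (y , x′<y , y<x″ , pk , z<y) =
              ⊥-elim (<⇒≱ z<y (≤-trans (proj₁ (dom y x′<y y<x″ pk)) (≮⇒≥ ≮)))

  dominated : ∀ v′ v″ → π D v′ ≡ x′ → π D v″ ≡ x″ → ∀ Z → v′ < Z → Z < v″ → IsPeak s Z →
    heightAt h s Z ≤ heightAt h s X × (heightAt h s Z ≡ heightAt h s X → X ≤ Z)
  dominated v′ v″ refl refl Z v′<Z Z<v″ pk
    with below (π D Z) (π-mono D (<⇒≤ v′<Z)) (π-mono D (<⇒≤ Z<v″))
  ... | inj₁ lt =
        subst₂ _≤_ (sym (height-peak-π D h Z pk)) (sym (height-raised h R)) (s≤s (<⇒≤ lt)) ,
        λ eq → ⊥-elim (<⇒≢ lt (suc-injective (trans (sym (height-peak-π D h Z pk)) (trans eq (height-raised h R)))))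
  ... | inj₂ (eq , x≤πZ) =
        ≤-reflexive (trans (height-peak-π D h Z pk) (trans (cong suc eq) (sym (height-raised h R)))) ,
        λ _ → after (m≤n⇒m<n∨m≡n x≤πZ)
    where
    after : x < π D Z ⊎ x ≡ π D Z → X ≤ Z
    after (inj₁ lt) = <⇒≤ (π-reflects-< D (subst (_< π D Z) (sym (π-raised R)) lt))
    after (inj₂ eq) = raised-first R Z pk (sym eq)

-- Project the window along `π`. Its ends become no higher while the peak loses one, so the depth r
-- is reached at least and `tighten` restores equality.
admissible-raised⁻ : ∀ {h gs w s x X r} {D : Ins gs w s} → Raised D x X → 1 ≤ r →
  RelAdmissible h s X (suc r) → RelAdmissible h w x r
admissible-raised⁻ {h} {w = w} {s} {x} {X} {r} {D} R 1≤r (v′ , v″ , v′<X , X<v″ , _ , p , q , dom) =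
  tighten 1≤r
    ( π D v′ , π D v″
    , ≤∧≢⇒< (subst (π D v′ ≤_) (π-raised R) (π-mono D (<⇒≤ v′<X))) (apart (drop v′ p))
    , ≤∧≢⇒< (subst (_≤ π D v″) (π-raised R) (π-mono D (<⇒≤ X<v″))) (λ eq → apart (drop v″ q) (sym eq))
    , π-≤length D v″
    , drop v′ p , drop v″ q , dominated )
  where
  drop : ∀ v → heightAt h s v + suc r ≡ heightAt h s X → heightAt h w (π D v) + r ≤ heightAt h w x
  drop v eq = suc-≤-cancel (≤-trans (+-monoˡ-≤ (suc r) (proj₁ (height-π D h v)))
                (≤-reflexive (trans eq (height-raised h R))))

  apart : ∀ {y} → heightAt h w y + r ≤ heightAt h w x → y ≢ x
  apart le refl = <⇒≱ (m<m+n (heightAt h w x) 1≤r) le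

  dominated : ∀ z → π D v′ < z → z < π D v″ → IsPeak w z →
    heightAt h w z ≤ heightAt h w x × (heightAt h w z ≡ heightAt h w x → x ≤ z)
  dominated z v′<z z<v″ pk =
    let Z , RZ = raise-peak D z pk
        le , tie = dom Z (π-reflects-< D (subst (π D v′ <_) (sym (π-raised RZ)) v′<z))
                         (π-reflects-< D (subst (_< π D v″) (sym (π-raised RZ)) z<v″)) (raised-peak RZ)
    in ≤-pred (subst₂ _≤_ (height-raised h RZ) (height-raised h R) le) ,
       λ eq → subst₂ _≤_ (π-raised R) (π-raised RZ)
                (π-mono D (tie (trans (height-raised h RZ) (trans (cong suc eq) (sym (height-raised h R))))))

-- A window of depth 2 or more would project to one whose ends are strictly below the vertex of X.
-- By `climb` that vertex is a peak of w, whose raised copy ties with X from the left, or there is a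
-- higher peak of w, whose raised copy exceeds X; domination forbids both.
admissible-extra : ∀ {h gs w s X r} {D : Ins gs w s} → Walk h w → Extra D X →
  RelAdmissible h s X r → r ≤ 1
admissible-extra {r = zero}     _ _ _ = z≤n
admissible-extra {r = suc zero} _ _ _ = ≤-refl
admissible-extra {h} {w = w} {s} {X} {suc (suc r)} {D} W x (v′ , v″ , v′<X , X<v″ , _ , p , q , dom) =
  ⊥-elim (absurd (climb W left right (π-≤length D v″) (drop v′ p) (drop v″ q)))
  where
  drop : ∀ v → heightAt h s v + suc (suc r) ≡ heightAt h s X → heightAt h w (π D v) < heightAt h w (π D X)
  drop v eq = ≤-trans
    (subst (suc (heightAt h w (π D v)) ≤_) (sym (+-suc _ r)) (s≤s (m≤m+n _ r)))
    (suc-≤-cancel (≤-trans (+-monoˡ-≤ (suc (suc r)) (proj₁ (height-π D h v)))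
                (≤-reflexive (trans eq (height-extra h x)))))

  left : π D v′ < π D X
  left = ≤∧≢⇒< (π-mono D (<⇒≤ v′<X)) (λ eq → <⇒≢ (drop v′ p) (cong (heightAt h w) eq))

  right : π D X < π D v″
  right = ≤∧≢⇒< (π-mono D (<⇒≤ X<v″)) (λ eq → <⇒≢ (drop v″ q) (cong (heightAt h w) (sym eq)))

  absurd : IsPeak w (π D X) ⊎ (∃ λ y → π D v′ < y × y < π D v″ × IsPeak w y × heightAt h w (π D X) < heightAt h w y) → ⊥
  absurd (inj₁ pk) =
    let Z , RZ = raise-peak D (π D X) pk
        Z<X = ≤∧≢⇒< (raised-first RZ X (extra-peak x) refl)
                (λ eq → raised-not-extra RZ (subst (Extra D) (sym eq) x))
        _ , tie = dom Z (π-reflects-< D (subst (π D v′ <_) (sym (π-raised RZ)) left)) (<-trans Z<X X<v″) (raised-peak RZ)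
    in <⇒≱ Z<X (tie (trans (height-raised h RZ) (sym (height-extra h x))))
  absurd (inj₂ (y , a , b , pk , higher)) =
    let Z , RZ = raise-peak D y pk
        le , _ = dom Z (π-reflects-< D (subst (π D v′ <_) (sym (π-raised RZ)) a))
                       (π-reflects-< D (subst (_< π D v″) (sym (π-raised RZ)) b)) (raised-peak RZ)
    in <⇒≱ (subst₂ _<_ (sym (height-extra h x)) (sym (height-raised h RZ)) (s≤s higher)) le

relHeight-raised : ∀ {h gs w s x X r} {D : Ins gs w s} → Walk h w → Raised D x X →
  IsRelHeight h w x r → IsRelHeight h s X (suc r)
relHeight-raised {h} {w = w} {s} {x} {X} {r} W R rel@(adm , max) =
  admissible-raised W R 1≤r adm , bound
  where
  1≤r = relHeight-≥1 W (raised-base R) rel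
  bound : ∀ r′ → RelAdmissible h s X r′ → r′ ≤ suc r
  bound zero           _ = z≤n
  bound (suc zero)     _ = s≤s z≤n
  bound (suc (suc r′)) a = s≤s (max (suc r′) (admissible-raised⁻ R (s≤s z≤n) a))

relHeight-raised⁻ : ∀ {h gs w s x X r} {D : Ins gs w s} → Walk h w → Raised D x X →
  IsRelHeight h s X r → ∃ λ r′ → r ≡ suc r′ × IsRelHeight h w x r′
relHeight-raised⁻ {h} {w = w} {s} {x} {X} {r} W R (adm , max)
  -- The peak x admits 1, so X admits 2; hence r is the successor of a positive number.
  with max 2 (admissible-raised W R ≤-refl (peak-admits-1 W (raised-base R)))
... | s≤s {n = r′} 1≤r′ = r′ , refl , admissible-raised⁻ R 1≤r′ adm , bound
  where
  bound : ∀ r″ → RelAdmissible h w x r″ → r″ ≤ r′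
  bound zero     _ = z≤n
  bound (suc r″) a = ≤-pred (max (suc (suc r″)) (admissible-raised W R (s≤s z≤n) a))

relHeight-extra : ∀ {h gs w s X} {D : Ins gs w s} → Walk h w → Extra D X → IsRelHeight h s X 1
relHeight-extra {D = D} W x =
  peak-admits-1 (walk-Ins D W) (extra-peak x) , (λ _ → admissible-extra W x)

-- Good paths

suc-%2 : ∀ m n → m % 2 ≡ n % 2 → suc m % 2 ≡ suc n % 2
suc-%2 zero          zero          eq = refl
suc-%2 zero          (suc (suc n)) eq = suc-%2 zero n eq
suc-%2 (suc zero)    (suc zero)    eq = refl
suc-%2 (suc zero)    (suc (suc n)) eq = suc-%2 (suc zero) n eq
suc-%2 (suc (suc m)) n             eq = suc-%2 m n eq

suc-%2⁻ : ∀ m n → suc m % 2 ≡ suc n % 2 → m % 2 ≡ n % 2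
suc-%2⁻ m n = suc-%2 (suc m) (suc n)

-- Says that all insertions are at even abscissae when w itself begins at abscissa o: the first
-- distance compensates the parity of o, the later ones are differences of even numbers.
EvenFrom : ℕ → List ℕ → Set
EvenFrom o []       = ⊤
EvenFrom o (g ∷ gs) = g % 2 ≡ o % 2 × All (λ g → g % 2 ≡ 0) gs

evenFrom-bump : ∀ o gs → EvenFrom (suc o) gs → EvenFrom o (bump gs)
evenFrom-bump o []       _          = tt
evenFrom-bump o (g ∷ gs) (eq , evs) = suc-%2 g (suc o) eq , evs

evenFrom-bump⁻ : ∀ o gs → EvenFrom o (bump gs) → EvenFrom (suc o) gs
evenFrom-bump⁻ o []       _          = tt
evenFrom-bump⁻ o (g ∷ gs) (eq , evs) = suc-%2 (suc g) o eq , evs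

evenFrom-even : ∀ {o} gs → 0 ≡ o % 2 → All (λ g → g % 2 ≡ 0) gs → EvenFrom o gs
evenFrom-even []       _  _          = tt
evenFrom-even (g ∷ gs) o≡ (eq ∷ evs) = trans eq o≡ , evs

evenFrom-even⁻ : ∀ {o} gs → 0 ≡ o % 2 → EvenFrom o gs → All (λ g → g % 2 ≡ 0) gs
evenFrom-even⁻ []       _  _          = []
evenFrom-even⁻ (g ∷ gs) o≡ (eq , evs) = trans eq (sym o≡) ∷ evs

-- Inserted pairs have length two, so abscissae in s and w agree modulo 2; the peak comes one step
-- after its place of insertion.
extra-parity : ∀ {gs w s X} {D : Ins gs w s} o → EvenFrom o gs → Extra D X → X % 2 ≡ suc o % 2
extra-parity o (eq , _) here = suc-%2 0 o eq
extra-parity o (eq , evs) (extra {gs} x) = extra-parity o (evenFrom-even gs eq evs) x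
extra-parity o ev (tail {g} {gs} {X = X} x) =
  suc-%2 X o (extra-parity (suc o) (evenFrom-bump⁻ o (g ∷ gs) ev) x)
extra-parity o ev (keep {gs} {X = X} x) =
  suc-%2 X o (extra-parity (suc o) (evenFrom-bump⁻ o gs ev) x)
extra-parity o ev (summit {gs} {X = X} x) =
  suc-%2 X o (extra-parity (suc o) (evenFrom-bump⁻ o gs ev) x)

extra-parity⁻ : ∀ {gs w s} (D : Ins gs w s) o → (∀ X → Extra D X → X % 2 ≡ suc o % 2) → EvenFrom o gs
extra-parity⁻ done o odd = tt
extra-parity⁻ (extra {gs} D) o odd =
  let o≡ = suc-%2⁻ 0 o (odd 1 here)
  in o≡ , evenFrom-even⁻ gs o≡ (extra-parity⁻ D o (λ X x → odd (2 + X) (extra x)))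
extra-parity⁻ (tail {g} {gs} D) o odd =
  evenFrom-bump o (g ∷ gs) (extra-parity⁻ D (suc o) (λ X x → suc-%2⁻ X (suc (suc o)) (odd (suc X) (tail x))))
extra-parity⁻ (keep {gs} t flat D) o odd =
  evenFrom-bump o gs (extra-parity⁻ D (suc o) (λ X x → suc-%2⁻ X (suc (suc o)) (odd (suc X) (keep x))))
extra-parity⁻ (summit {gs} D) o odd =
  evenFrom-bump o gs (extra-parity⁻ D (suc o) (λ X x → suc-%2⁻ X (suc (suc o)) (odd (3 + X) (summit x))))

raised-parity : ∀ {gs w s x X} {D : Ins gs w s} → Raised D x X → X % 2 ≡ suc x % 2
raised-parity here = refl
raised-parity (extra r) = raised-parity r
raised-parity (keep {x = x} {X} r) = suc-%2 X (suc x) (raised-parity r)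
raised-parity (summit {x = x} {X} r) = suc-%2 X (suc x) (raised-parity r)

-- SPath without the major index, for an arbitrary starting height h.
Good : ℕ → ℕ → List Step → Set
Good k h s =
  Walk h s × EndsWell s ×
  (∀ x → x ≤ length s → heightAt h s x ≤ k) ×
  (∀ x r → IsPeak s x → IsRelHeight h s x r → r ≡ k ⊎ r ≡ k ∸ 1 → countE (take x s) % 4 ≡ 0) ×
  (∀ x r → IsPeak s x → IsRelHeight h s x r → x % 2 ≡ r % 2)

-- Since K is at least 2, no extra peak has relative height K or K + 1. The condition on E steps
-- thus only concerns raised peaks, whose counts of E steps are unchanged.
good-raise : ∀ {K h gs w s} → 2 ≤ K → Ins gs w s → EvenFrom 0 gs → Good K h w → Good (suc K) h s
good-raise {K} {h} {gs} {w} {s} 2≤K D ev (W , ends , bound , fours , parity) =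
  walk-Ins D W ,
  noFinalE⇒endsWell (walk-Ins D W) (noFinalE-Ins D (endsWell⇒noFinalE ends)) ,
  (λ v _ → ≤-trans (proj₂ (height-π D h v)) (s≤s (bound (π D v) (π-≤length D v)))) ,
  fours′ , parity′
  where
  fours′ : ∀ X r → IsPeak s X → IsRelHeight h s X r → r ≡ suc K ⊎ r ≡ K → countE (take X s) % 4 ≡ 0
  fours′ X r pk rel big with classify D X pk
  ... | inj₁ x = ⊥-elim (<⇒≱ 2≤K (≤-trans (large big) (admissible-extra W x (proj₁ rel))))
    where
    large : r ≡ suc K ⊎ r ≡ K → K ≤ r
    large (inj₁ refl) = n≤1+n K
    large (inj₂ refl) = ≤-refl
  ... | inj₂ (x , R) with relHeight-raised⁻ W R rel
  ...   | r′ , refl , rel′ =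
          trans (cong (_% 4) (countE-raised R))
            (fours x r′ (raised-base R) rel′ (Sum.map suc-injective (cong pred) big))

  parity′ : ∀ X r → IsPeak s X → IsRelHeight h s X r → X % 2 ≡ r % 2
  parity′ X r pk rel with classify D X pk
  ... | inj₁ x = trans (extra-parity 0 ev x)
                   (cong (_% 2) (≤-antisym (relHeight-≥1 (walk-Ins D W) pk rel) (admissible-extra W x (proj₁ rel))))
  ... | inj₂ (x , R) with relHeight-raised⁻ W R rel
  ...   | r′ , refl , rel′ = trans (raised-parity R) (suc-%2 x r′ (parity x r′ (raised-base R) rel′))

-- The bound on s yields the bound K at the peaks of w. A vertex above K elsewhere would force a
-- higher peak, since both ends of w are at most K; for the starting point this is the hypothesis
-- `h ≤ K`.
good-raise⁻ : ∀ {K h gs w s} → 1 ≤ K → h ≤ K → Ins gs w s → NoFinalE w → Good (suc K) h s → Good K h w × EvenFrom 0 gs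
good-raise⁻ {K} {h} {gs} {w} {s} 1≤K h≤K D ok (W′ , _ , bound , fours , parity) =
  (W , noFinalE⇒endsWell W ok , bound′ , fours′ , parity′) ,
  extra-parity⁻ D 0 (λ X x → parity X 1 (extra-peak x) (relHeight-extra W x))
  where
  W = walk-Ins⁻ D W′

  bound-peak : ∀ x → IsPeak w x → heightAt h w x ≤ K
  bound-peak x pk =
    let X , R = raise-peak D x pk
    in ≤-pred (subst (_≤ suc K) (height-raised h R) (bound X (peak-≤length (raised-peak R))))

  bound′ : ∀ x → x ≤ length w → heightAt h w x ≤ K
  bound′ zero _ = h≤K
  bound′ (suc x) x≤ with m≤n⇒m<n∨m≡n x≤
  ... | inj₂ eq = ≤-trans (≤-reflexive (trans (cong (heightAt h w) eq) (height-end W))) z≤n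
  ... | inj₁ x< with heightAt h w (suc x) ≤? K
  ...   | yes le = le
  ...   | no ≰ with climb W {0} {suc x} {length w} (s≤s z≤n) x< ≤-refl
                      (≤-<-trans h≤K (≰⇒> ≰))
                      (≤-<-trans (≤-trans (≤-reflexive (height-end W)) z≤n) (≰⇒> ≰))
  ...     | inj₁ pk = bound-peak (suc x) pk
  ...     | inj₂ (p , _ , _ , pk , higher) = ≤-trans (<⇒≤ higher) (bound-peak p pk)

  fours′ : ∀ x r → IsPeak w x → IsRelHeight h w x r → r ≡ K ⊎ r ≡ K ∸ 1 → countE (take x w) % 4 ≡ 0
  fours′ x r pk rel big =
    let X , R = raise-peak D x pk
    in trans (cong (_% 4) (sym (countE-raised R)))
         (fours X (suc r) (raised-peak R) (relHeight-raised W R rel)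
           (Sum.map (cong suc) (λ eq → trans (cong suc eq) (suc-pred K {{>-nonZero 1≤K}})) big))

  parity′ : ∀ x r → IsPeak w x → IsRelHeight h w x r → x % 2 ≡ r % 2
  parity′ x r pk rel =
    let X , R = raise-peak D x pk
    in suc-%2⁻ x r (trans (sym (raised-parity R)) (parity X (suc r) (raised-peak R) (relHeight-raised W R rel)))

-- Depth 1 is admissible at every peak, so two sets of admissible depths that differ at most in
-- values up to 1 have the same maximum.
relHeight-transfer : ∀ {h s x h′ s′ x′} →
  (∀ r → RelAdmissible h s x r → RelAdmissible h′ s′ x′ r) →
  (∀ r → RelAdmissible h′ s′ x′ r → r ≤ 1 ⊎ RelAdmissible h s x r) →
  RelAdmissible h s x 1 → ∀ {r} → IsRelHeight h s x r → IsRelHeight h′ s′ x′ r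
relHeight-transfer up down one (adm , max) = up _ adm , bound
  where
  bound : ∀ r′ → _ → r′ ≤ _
  bound r′ a with down r′ a
  ... | inj₁ r′≤1 = ≤-trans r′≤1 (max 1 one)
  ... | inj₂ a′   = max r′ a′

relHeight-transfer⁻ : ∀ {h s x h′ s′ x′} →
  (∀ r → RelAdmissible h s x r → RelAdmissible h′ s′ x′ r) →
  (∀ r → RelAdmissible h′ s′ x′ r → r ≤ 1 ⊎ RelAdmissible h s x r) →
  RelAdmissible h s x 1 → ∀ {r} → IsRelHeight h′ s′ x′ r → IsRelHeight h s x r
relHeight-transfer⁻ {h} {s} {x} up down one {r} (adm , max) = adm′ , (λ r′ a → max r′ (up r′ a))
  where
  adm′ : RelAdmissible h s x r
  adm′ with down r adm
  ... | inj₁ r≤1 = subst (RelAdmissible h s x) (≤-antisym (max 1 (up 1 one)) r≤1) one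
  ... | inj₂ a   = a

-- Relative heights behind a prefix

peak-prefix : ∀ p {s x} → IsPeak s x → IsPeak (p ++ s) (length p + x)
peak-prefix []      pk = pk
peak-prefix (u ∷ p) pk = peak-cons (peak-prefix p pk)

peak-prefix⁻ : ∀ p {s x} → IsPeak (p ++ s) (length p + suc x) → IsPeak s (suc x)
peak-prefix⁻ []          pk = pk
peak-prefix⁻ (u ∷ p) {s} {x} pk =
  peak-prefix⁻ p (subst (IsPeak (p ++ s)) (sym (+-suc (length p) x))
    (peak-tail (subst (λ n → IsPeak (u ∷ p ++ s) (suc n)) (+-suc (length p) x) pk)))

length-prefix : ∀ p (s : List Step) → length (p ++ s) ≡ length p + length s
length-prefix []      s = refl
length-prefix (u ∷ p) s = cong suc (length-prefix p s)

module Prefix (p : List Step) {h h′ : ℕ} {s : List Step}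
              (heights : ∀ x → heightAt h (p ++ s) (length p + x) ≡ heightAt h′ s x) where

  private
    l = length p

    split : ∀ {z} → l ≤ z → ∃ λ y → z ≡ l + y
    split {z} l≤z = z ∸ l , sym (m+[n∸m]≡n l≤z)

  prefix-admissible : ∀ {x r} → RelAdmissible h′ s x r → RelAdmissible h (p ++ s) (l + x) r
  prefix-admissible {x} {r} (x′ , x″ , a , b , c , eq′ , eq″ , dom) =
    l + x′ , l + x″ , +-monoʳ-< l a , +-monoʳ-< l b ,
    ≤-trans (+-monoʳ-≤ l c) (≤-reflexive (sym (length-prefix p s))) ,
    trans (cong (_+ r) (heights x′)) (trans eq′ (sym (heights x))) ,
    trans (cong (_+ r) (heights x″)) (trans eq″ (sym (heights x))) ,
    dominated
    where
    dominated : ∀ Z → l + x′ < Z → Z < l + x″ → IsPeak (p ++ s) Z →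
      heightAt h (p ++ s) Z ≤ heightAt h (p ++ s) (l + x) ×
      (heightAt h (p ++ s) Z ≡ heightAt h (p ++ s) (l + x) → l + x ≤ Z)
    dominated Z lo hi pk with split (≤-trans (m≤m+n l x′) (<⇒≤ lo))
    ... | zero  , refl = ⊥-elim (n≮0 (+-cancelˡ-< l x′ 0 lo))
    ... | suc z , refl =
          let le , tie = dom (suc z) (+-cancelˡ-< l x′ _ lo) (+-cancelˡ-< l _ x″ hi) (peak-prefix⁻ p pk)
          in subst₂ _≤_ (sym (heights (suc z))) (sym (heights x)) le ,
             λ eq → +-monoʳ-≤ l (tie (trans (sym (heights (suc z))) (trans eq (heights x))))

  RightHalf : ℕ → ℕ → Set
  RightHalf x r = ∃ λ x″ → x < x″ × x″ ≤ length s × heightAt h′ s x″ + r ≡ heightAt h′ s x ×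
    (∀ z → z < x″ → IsPeak s z → heightAt h′ s z ≤ heightAt h′ s x × (heightAt h′ s z ≡ heightAt h′ s x → x ≤ z))

  private
    unshift : ∀ {x z} → heightAt h (p ++ s) (l + z) ≤ heightAt h (p ++ s) (l + x) ×
      (heightAt h (p ++ s) (l + z) ≡ heightAt h (p ++ s) (l + x) → l + x ≤ l + z) →
      heightAt h′ s z ≤ heightAt h′ s x × (heightAt h′ s z ≡ heightAt h′ s x → x ≤ z)
    unshift {x} {z} (le , tie) = subst₂ _≤_ (heights z) (heights x) le ,
      λ eq → +-cancelˡ-≤ l x z (tie (trans (heights z) (trans eq (sym (heights x)))))

  -- A window may begin inside the prefix. Then all of s up to its right end is dominated, and each
  -- application either bounds r through the height of the left end or supplies a new left end
  -- inside s.
  prefix-admissible⁻ : ∀ {x r} → RelAdmissible h (p ++ s) (l + x) r →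
    RelAdmissible h′ s x r ⊎
    ((∃ λ X′ → X′ < l × heightAt h (p ++ s) X′ + r ≡ heightAt h′ s x) × RightHalf x r)
  prefix-admissible⁻ {x} {r} (X′ , X″ , a , b , c , eq′ , eq″ , dom)
    with split (≤-trans (m≤m+n l x) (<⇒≤ b))
  ... | x″ , refl with X′ <? l
  ...   | yes X′<l = inj₂ ((X′ , X′<l , trans eq′ (heights x)) ,
            x″ , +-cancelˡ-< l x x″ b , c′ , trans (cong (_+ r) (sym (heights x″))) (trans eq″ (heights x)) ,
            λ z z<x″ pk → unshift (dom (l + z) (<-≤-trans X′<l (m≤m+n l z)) (+-monoʳ-< l z<x″) (peak-prefix p pk)))
    where
    c′ : x″ ≤ length s
    c′ = +-cancelˡ-≤ l x″ _ (≤-trans c (≤-reflexive (length-prefix p s)))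
  ...   | no X′≮l with split (≮⇒≥ X′≮l)
  ...     | x′ , refl = inj₁ (x′ , x″ , +-cancelˡ-< l x′ x a , +-cancelˡ-< l x x″ b ,
              +-cancelˡ-≤ l x″ _ (≤-trans c (≤-reflexive (length-prefix p s))) ,
              trans (cong (_+ r) (sym (heights x′))) (trans eq′ (heights x)) ,
              trans (cong (_+ r) (sym (heights x″))) (trans eq″ (heights x)) ,
              λ z x′<z z<x″ pk → unshift (dom (l + z) (+-monoʳ-< l x′<z) (+-monoʳ-< l z<x″) (peak-prefix p pk)))

-- Paths from the maximal height, and the base case

module _ {j : ℕ} {s : List Step} where

  private
    k = suc (suc j)
    module P = Prefix (SE ∷ SE ∷ []) {k} {j} {s} (λ _ → refl)

  -- A left end among the first two vertices has height k or k - 1, and no peak is higher than k.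
  admissible-descent⁻ : Walk j s → (∀ x → x ≤ length s → heightAt j s x ≤ k) → ∀ {x} r →
    RelAdmissible k (SE ∷ SE ∷ s) (2 + x) r → r ≤ 1 ⊎ RelAdmissible j s x r
  admissible-descent⁻ W bound {x} r adm with P.prefix-admissible⁻ adm
  ... | inj₁ a = inj₂ a
  ... | inj₂ ((X′ , X′<2 , eq) , _ , x< , x″≤ , _) = inj₁ (low X′ X′<2 eq)
    where
    top : heightAt j s x ≤ k
    top = bound x (<⇒≤ (<-≤-trans x< x″≤))
    low : ∀ X′ → X′ < 2 → heightAt k (SE ∷ SE ∷ s) X′ + r ≡ heightAt j s x → r ≤ 1
    low zero _ eq = ≤-trans (+-cancelˡ-≤ k r 0 (≤-trans (≤-reflexive eq) (≤-trans top (≤-reflexive (sym (+-identityʳ k)))))) z≤n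
    low (suc zero) _ eq = +-cancelˡ-≤ (suc j) r 1 (≤-trans (≤-reflexive eq) (≤-trans top (≤-reflexive (sym (+-comm (suc j) 1)))))
    low (suc (suc _)) (s≤s (s≤s ())) _

  peak-descent : ∀ {x} → IsPeak (SE ∷ SE ∷ s) x → ∃ λ y → x ≡ 2 + y × IsPeak s y
  peak-descent {suc zero} (() , _)
  peak-descent {suc (suc zero)} (there () , _)
  peak-descent {suc (suc (suc x))} pk = suc x , refl , peak-tail (peak-tail pk)

  good-descent : Good k j s → Good k k (SE ∷ SE ∷ s)
  good-descent (W , ends , bound , fours , parity) =
    se (se W) , noFinalE⇒endsWell (se (se W)) (endsWell⇒noFinalE ends) , bound′ , fours′ , parity′
    where
    bound′ : ∀ x → x ≤ suc (suc (length s)) → heightAt k (SE ∷ SE ∷ s) x ≤ k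
    bound′ zero          _             = ≤-refl
    bound′ (suc zero)    _             = n≤1+n _
    bound′ (suc (suc x)) (s≤s (s≤s p)) = bound x p

    rel⁻ : ∀ {x r} → IsPeak s x → IsRelHeight k (SE ∷ SE ∷ s) (2 + x) r → IsRelHeight j s x r
    rel⁻ pk = relHeight-transfer⁻ (λ _ → P.prefix-admissible) (admissible-descent⁻ W bound) (peak-admits-1 W pk)

    fours′ : ∀ x r → IsPeak (SE ∷ SE ∷ s) x → IsRelHeight k (SE ∷ SE ∷ s) x r →
      r ≡ k ⊎ r ≡ suc j → countE (take x (SE ∷ SE ∷ s)) % 4 ≡ 0
    fours′ x r pk rel big with peak-descent pk
    ... | y , refl , pk′ = fours y r pk′ (rel⁻ pk′ rel) big

    parity′ : ∀ x r → IsPeak (SE ∷ SE ∷ s) x → IsRelHeight k (SE ∷ SE ∷ s) x r → x % 2 ≡ r % 2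
    parity′ x r pk rel with peak-descent pk
    ... | y , refl , pk′ = parity y r pk′ (rel⁻ pk′ rel)

  good-descent⁻ : Good k k (SE ∷ SE ∷ s) → Good k j s
  good-descent⁻ (se (se W) , ends , bound , fours , parity) =
    W , noFinalE⇒endsWell W (endsWell⇒noFinalE ends) , bound′ ,
    (λ x r pk rel → fours (2 + x) r (peak-prefix (SE ∷ SE ∷ []) pk) (rel⁺ pk rel)) ,
    (λ x r pk rel → parity (2 + x) r (peak-prefix (SE ∷ SE ∷ []) pk) (rel⁺ pk rel))
    where
    bound′ : ∀ x → x ≤ length s → heightAt j s x ≤ k
    bound′ x p = bound (2 + x) (s≤s (s≤s p))
    rel⁺ : ∀ {x r} → IsPeak s x → IsRelHeight j s x r → IsRelHeight k (SE ∷ SE ∷ s) (2 + x) r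
    rel⁺ pk = relHeight-transfer (λ _ → P.prefix-admissible) (admissible-descent⁻ W bound′) (peak-admits-1 W pk)

-- From the maximal height the path must go down twice: otherwise its first peak has abscissa 2
-- but relative height 1.
good-top : ∀ {j s} → Good (2 + j) (2 + j) s → ∃ λ s′ → s ≡ SE ∷ SE ∷ s′
good-top (ne W , _ , bound , _) = ⊥-elim (<-irrefl refl (bound 1 (s≤s z≤n)))
good-top (se (se W) , _) = _ , refl
good-top (se (ne (ne W)) , _ , bound , _) = ⊥-elim (<-irrefl refl (bound 3 (s≤s (s≤s (s≤s z≤n)))))
good-top {j} {s = s} (W@(se (ne (se _))) , _ , _ , _ , parity) =
  ⊥-elim (0≢1+n (parity 2 1 pk (peak-admits-1 W pk , low)))
  where
  pk : IsPeak s 2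
  pk = there here , there (there here)
  low : ∀ r → RelAdmissible (2 + j) s 2 r → r ≤ 1
  low r (zero , _ , _ , _ , _ , eq , _) = ≤-trans (≤-reflexive (m+n≡m⇒n≡0 (2 + j) eq)) z≤n
    where
    m+n≡m⇒n≡0 : ∀ m {n} → m + n ≡ m → n ≡ 0
    m+n≡m⇒n≡0 m {n} eq = +-cancelˡ-≡ m n 0 (trans eq (sym (+-identityʳ m)))
  low r (suc zero , _ , _ , _ , _ , eq , _) = ≤-reflexive (+-cancelˡ-≡ (suc j) r 1 (trans eq (+-comm 1 (suc j))))
  low r (suc (suc _) , _ , s≤s (s≤s ()) , _)

-- `quad` asks for a non-empty rest, so that no path ends with E.
data Base : List Step → Set where
  []   : Base []
  quad : ∀ {t s} → Base (t ∷ s) → Base (E ∷ E ∷ E ∷ E ∷ t ∷ s)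
  low  : ∀ {s} → Base s → Base (NE ∷ SE ∷ s)
  high : ∀ {s} → Base s → Base (NE ∷ NE ∷ SE ∷ SE ∷ s)

base-walk : ∀ {s} → Base s → Walk 0 s
base-walk []       = stop
base-walk (quad b) = e (e (e (e (base-walk b))))
base-walk (low b)  = ne (se (base-walk b))
base-walk (high b) = ne (ne (se (se (base-walk b))))

base-noFinalE : ∀ {s} → Base s → NoFinalE s
base-noFinalE []       = tt
base-noFinalE (quad b) = base-noFinalE b
base-noFinalE (low b)  = base-noFinalE b
base-noFinalE (high b) = base-noFinalE b

base-bound : ∀ {s} → Base s → ∀ x → heightAt 0 s x ≤ 2
base-bound []       x = ≤-trans (≤-reflexive (height-[] 0 x)) z≤n
base-bound (quad b) 0 = z≤n
base-bound (quad b) 1 = z≤n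
base-bound (quad b) 2 = z≤n
base-bound (quad b) 3 = z≤n
base-bound (quad b) (suc (suc (suc (suc x)))) = base-bound b x
base-bound (low b)  0 = z≤n
base-bound (low b)  1 = s≤s z≤n
base-bound (low b)  (suc (suc x)) = base-bound b x
base-bound (high b) 0 = z≤n
base-bound (high b) 1 = s≤s z≤n
base-bound (high b) 2 = ≤-refl
base-bound (high b) 3 = s≤s z≤n
base-bound (high b) (suc (suc (suc (suc x)))) = base-bound b x

-- Together with `IsPeak s x` this gives NE NE SE SE around x; only the outer two steps are
-- recorded.
DoubleAscent : List Step → ℕ → Set
DoubleAscent s x = ∃ λ j → x ≡ 2 + j × StepAt s j NE × StepAt s (3 + j) SE

doubleAscent-cons : ∀ {t s x} → DoubleAscent s x → DoubleAscent (t ∷ s) (suc x)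
doubleAscent-cons (j , refl , up , down) = suc j , refl , there up , there down

BasePeak : List Step → ℕ → Set
BasePeak s x =
  countE (take x s) % 4 ≡ 0 ×
  ((x % 2 ≡ 1 × heightAt 0 s x ≡ 1) ⊎ (x % 2 ≡ 0 × heightAt 0 s x ≡ 2 × DoubleAscent s x))

base-peak : ∀ {s} → Base s → ∀ x → IsPeak s x → BasePeak s x
base-peak [] (suc x) (() , _)
base-peak (quad b) 1 (() , _)
base-peak (quad b) 2 (there () , _)
base-peak (quad b) 3 (there (there ()) , _)
base-peak (quad b) 4 (there (there (there ())) , _)
base-peak (quad b) (suc (suc (suc (suc (suc x))))) pk =
  let four , shape = base-peak b (suc x) (peak-tail (peak-tail (peak-tail (peak-tail pk))))
  in four , Sum.map₂ (λ { (p , q , r) → p , q , doubleAscent-cons (doubleAscent-cons (doubleAscent-cons (doubleAscent-cons r))) }) shape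
base-peak (low b) 1 pk = refl , inj₁ (refl , refl)
base-peak (low b) 2 (there () , _)
base-peak (low b) (suc (suc (suc x))) pk =
  let four , shape = base-peak b (suc x) (peak-tail (peak-tail pk))
  in four , Sum.map₂ (λ { (p , q , r) → p , q , doubleAscent-cons (doubleAscent-cons r) }) shape
base-peak (high b) 1 (_ , there ())
base-peak (high b) 2 pk = refl , inj₂ (refl , refl , 0 , refl , here , there (there (there here)))
base-peak (high b) 3 (there (there ()) , _)
base-peak (high b) 4 (there (there (there ())) , _)
base-peak (high b) (suc (suc (suc (suc (suc x))))) pk =
  let four , shape = base-peak b (suc x) (peak-tail (peak-tail (peak-tail (peak-tail pk))))
  in four , Sum.map₂ (λ { (p , q , r) → p , q , doubleAscent-cons (doubleAscent-cons (doubleAscent-cons (doubleAscent-cons r))) }) shape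

doubleAscent-admits-2 : ∀ {h s x} → Walk h s → IsPeak s x → DoubleAscent s x → RelAdmissible h s x 2
doubleAscent-admits-2 {h} {s} W pk@(up₂ , down₁) (j , refl , up₁ , down₂) =
  j , 4 + j , m<n⇒m<1+n ≤-refl , s≤s (s≤s (s≤s (n≤1+n j))) , stepAt-< down₂ ,
  trans (+-comm _ 2) (sym (trans (height-NE h up₂) (cong suc (height-NE h up₁)))) ,
  trans (+-comm _ 2) (sym (trans (height-SE W down₁) (cong suc (height-SE W down₂)))) ,
  only
  where
  only : ∀ z → j < z → z < 4 + j → IsPeak s z →
    heightAt h s z ≤ heightAt h s (2 + j) × (heightAt h s z ≡ heightAt h s (2 + j) → 2 + j ≤ z)
  -- Only the peak and its two neighbours lie inside the window, and neighbours of a peak are not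
  -- peaks.
  only z j<z (s≤s z≤) pk′ with m≤n⇒m<n∨m≡n j<z | m≤n⇒m<n∨m≡n z≤
  ... | inj₂ refl | _         = ⊥-elim (adjacent-not-peak pk′ pk)
  ... | inj₁ _    | inj₂ refl = ⊥-elim (adjacent-not-peak pk pk′)
  ... | inj₁ lo   | inj₁ (s≤s hi) with refl ← ≤-antisym lo hi = ≤-refl , (λ _ → ≤-refl)

relHeight-of-1 : ∀ {h s x r} → Walk h s → IsPeak s x → heightAt h s x ≡ 1 → IsRelHeight h s x r → r ≡ 1
relHeight-of-1 W pk eq rel@(adm , _) =
  ≤-antisym (subst (_ ≤_) eq (admissible-≤-height adm)) (relHeight-≥1 W pk rel)

relHeight-of-2 : ∀ {h s x r} → Walk h s → IsPeak s x → heightAt h s x ≡ 2 → DoubleAscent s x →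
  IsRelHeight h s x r → r ≡ 2
relHeight-of-2 W pk eq asc (adm , max) =
  ≤-antisym (subst (_ ≤_) eq (admissible-≤-height adm)) (max 2 (doubleAscent-admits-2 W pk asc))

base-good : ∀ {s} → Base s → Good 2 0 s
base-good {s} b =
  W , noFinalE⇒endsWell W (base-noFinalE b) , (λ x _ → base-bound b x) ,
  (λ x r pk _ _ → proj₁ (base-peak b x pk)) , parity
  where
  W = base-walk b
  parity : ∀ x r → IsPeak s x → IsRelHeight 0 s x r → x % 2 ≡ r % 2
  parity x r pk rel with proj₂ (base-peak b x pk)
  ... | inj₁ (odd , ht)        = trans odd (cong (_% 2) (sym (relHeight-of-1 W pk ht rel)))
  ... | inj₂ (even , ht , asc) = trans even (cong (_% 2) (sym (relHeight-of-2 W pk ht asc rel)))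

-- The conditions on the rest of a good path from a vertex on the x-axis that is preceded
-- by c steps E and has an abscissa of the same parity as c.
record Rest (c : ℕ) (s : List Step) : Set where
  constructor mkRest
  field
    walk       : Walk 0 s
    noFinalE   : NoFinalE s
    bounded    : ∀ x → x ≤ length s → heightAt 0 s x ≤ 2
    conditions : ∀ x r → IsPeak s x → IsRelHeight 0 s x r →
      (c + countE (take x s)) % 4 ≡ 0 × (c + x) % 2 ≡ r % 2

module _ (p : List Step) {s : List Step}
         (heights : ∀ x → heightAt 0 (p ++ s) (length p + x) ≡ heightAt 0 s x) where

  private module P = Prefix p {0} {0} {s} heights

  -- If the window begins in the prefix, the first vertex of s can replace its left end: it has
  -- height 0, hence is low enough, and `tighten` corrects the depth.
  admissible-ground⁻ : ∀ {x} → IsPeak s x → ∀ r →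
    RelAdmissible 0 (p ++ s) (length p + x) r → r ≤ 1 ⊎ RelAdmissible 0 s x r
  admissible-ground⁻ pk zero adm = inj₁ z≤n
  admissible-ground⁻ {suc x} pk (suc r) adm with P.prefix-admissible⁻ adm
  ... | inj₁ a = inj₂ a
  ... | inj₂ ((X′ , _ , eq) , x″ , a , b , c , dom) =
    inj₂ (tighten (s≤s z≤n)
      (0 , x″ , s≤s z≤n , a , b , ≤-trans (m≤n+m (suc r) _) (≤-reflexive eq) , ≤-reflexive c , (λ z _ → dom z)))

  relHeight-ground : ∀ {x r} → Walk 0 s → IsPeak s x → IsRelHeight 0 s x r →
    IsRelHeight 0 (p ++ s) (length p + x) r
  relHeight-ground W pk = relHeight-transfer (λ _ → P.prefix-admissible) (admissible-ground⁻ pk) (peak-admits-1 W pk)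

  rest-drop : ∀ {c c′} → Rest c (p ++ s) → Walk 0 s → NoFinalE s →
    (∀ x → c + countE (take (length p + x) (p ++ s)) ≡ c′ + countE (take x s)) →
    (∀ x → (c + (length p + x)) % 2 ≡ (c′ + x) % 2) →
    Rest c′ s
  rest-drop {c} {c′} (mkRest _ _ bound peak-conditions) W ok counts parities =
    mkRest W ok
    (λ x x≤ → subst (_≤ 2) (heights x)
      (bound (length p + x) (≤-trans (+-monoʳ-≤ _ x≤) (≤-reflexive (sym (length-prefix p s))))))
    (λ x r pk rel →
      let four , parity = peak-conditions (length p + x) r (peak-prefix p pk) (relHeight-ground W pk rel)
      in trans (cong (_% 4) (sym (counts x))) four , trans (sym (parities x)) parity)

rest-E : ∀ {c s} → Rest c (E ∷ s) → Rest (suc c) s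
rest-E {c} {s} rest@(mkRest (e W) ok _ _) =
  rest-drop (E ∷ []) (λ _ → refl) rest W (noFinalE-tail E {s} ok)
    (λ x → +-suc c _) (λ x → cong (_% 2) (+-suc c x))

rest-low : ∀ {c s} → Rest c (NE ∷ SE ∷ s) → c % 4 ≡ 0 × Rest c s
rest-low {c} rest@(mkRest W′@(ne (se W)) ok _ conditions) =
  trans (cong (_% 4) (sym (+-identityʳ c)))
    (proj₁ (conditions 1 1 pk (peak-admits-1 W′ pk , (λ r adm → admissible-≤-height adm)))) ,
  rest-drop (NE ∷ SE ∷ []) (λ _ → refl) rest W ok (λ _ → refl)
    (λ x → cong (_% 2) (trans (+-suc c (suc x)) (cong suc (+-suc c x))))
  where
  pk : IsPeak (NE ∷ SE ∷ _) 1
  pk = here , there here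

rest-high : ∀ {c s} → Rest c (NE ∷ NE ∷ SE ∷ SE ∷ s) → c % 4 ≡ 0 × Rest c s
rest-high {c} rest@(mkRest W′@(ne (ne (se (se W)))) ok _ conditions) =
  trans (cong (_% 4) (sym (+-identityʳ c)))
    (proj₁ (conditions 2 2 pk
      (doubleAscent-admits-2 W′ pk (0 , refl , here , there (there (there here))) ,
       (λ r adm → admissible-≤-height adm)))) ,
  rest-drop (NE ∷ NE ∷ SE ∷ SE ∷ []) (λ _ → refl) rest W ok (λ _ → refl)
    (λ x → trans (cong (_% 2) (trans (+-suc c (3 + x)) (cong suc (+-suc c (2 + x)))))
                 (cong (_% 2) (trans (+-suc c (suc x)) (cong suc (+-suc c x)))))
  where
  pk : IsPeak (NE ∷ NE ∷ SE ∷ _) 2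
  pk = there here , there (there here)

even-not-odd : ∀ c → c % 4 ≡ 0 → c % 2 ≢ 1
even-not-odd zero _ ()
even-not-odd (suc (suc (suc (suc c)))) eq = even-not-odd c eq

-- The second of two peaks of height 2 without a return to the x-axis in between has relative
-- height 1 but an even abscissa.
rest-no-plateau : ∀ {c s} → ¬ Rest c (NE ∷ NE ∷ SE ∷ NE ∷ SE ∷ s)
rest-no-plateau {c} {s} (mkRest W _ _ conditions) =
  let four , parity = conditions 4 1 pk (peak-admits-1 W pk , bound)
  in even-not-odd c (trans (cong (_% 4) (sym (+-identityʳ c))) four)
       (trans (cong (_% 2) (sym (+-comm c 4))) parity)
  where
  path = NE ∷ NE ∷ SE ∷ NE ∷ SE ∷ s
  pk : IsPeak path 4
  pk = there (there (there here)) , there (there (there (there here)))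
  first : ∀ x′ x″ → x′ < 2 → 4 < x″ →
    ¬ (∀ z → x′ < z → z < x″ → IsPeak path z → heightAt 0 path z ≤ 2 × (heightAt 0 path z ≡ 2 → 4 ≤ z))
  first x′ x″ x′<2 4<x″ dom
    with s≤s (s≤s ()) ← proj₂ (dom 2 x′<2 (<-trans (s≤s (s≤s (s≤s z≤n))) 4<x″) (there here , there (there here))) refl
  bound : ∀ r → RelAdmissible 0 path 4 r → r ≤ 1
  bound r (0 , x″ , _ , b , _ , _ , _ , dom) = ⊥-elim (first 0 x″ (s≤s z≤n) b dom)
  bound r (1 , x″ , _ , b , _ , _ , _ , dom) = ⊥-elim (first 1 x″ ≤-refl b dom)
  bound r (2 , _ , _ , _ , _ , eq , _) = ≤-trans (≤-reflexive (+-cancelˡ-≡ 2 r 0 eq)) z≤n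
  bound r (3 , _ , _ , _ , _ , eq , _) = ≤-reflexive (+-cancelˡ-≡ 1 r 1 eq)
  bound r (suc (suc (suc (suc _))) , _ , s≤s (s≤s (s≤s (s≤s ()))) , _)

-- The step opens a hill, whose peak is subject to the condition on E steps.
rest-NE : ∀ {c s} → Rest c (NE ∷ s) → c % 4 ≡ 0
rest-NE rest@(mkRest (ne (se W)) _ _ _) = proj₁ (rest-low rest)
rest-NE rest@(mkRest (ne (ne (se (se W)))) _ _ _) = proj₁ (rest-high rest)
rest-NE rest@(mkRest (ne (ne (se (ne (se W))))) _ _ _) = ⊥-elim (rest-no-plateau rest)
rest-NE (mkRest (ne (ne (ne W))) _ bound _) with s≤s (s≤s ()) ← bound 3 (s≤s (s≤s (s≤s z≤n)))
rest-NE (mkRest (ne (ne (se (ne (ne W))))) _ bound _)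
  with s≤s (s≤s ()) ← bound 5 (s≤s (s≤s (s≤s (s≤s (s≤s z≤n)))))

four-apart : ∀ c i → c % 4 ≡ 0 → i < 4 → (i + c) % 4 ≡ 0 → i ≡ 0
four-apart zero 0 _ _ _ = refl
four-apart zero (suc (suc (suc (suc i)))) _ (s≤s (s≤s (s≤s (s≤s ())))) _
four-apart (suc (suc (suc (suc c)))) i eq i< eq′ =
  four-apart c i eq i< (trans (cong (_% 4) (sym (shift i c))) eq′)
  where
  shift : ∀ i c → i + (4 + c) ≡ 4 + (i + c)
  shift i c = trans (sym (+-assoc i 4 c)) (trans (cong (_+ c) (+-comm i 4)) (+-assoc 4 i c))

-- The height bound 2 and the absence of plateaus leave two hills. As c stays divisible by 4, a hill
-- after one, two or three E steps contradicts `rest-NE`, so E steps come in fours.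
rest-base : ∀ {c} s → c % 4 ≡ 0 → Rest c s → Base s
rest-base [] _ _ = []
rest-base (SE ∷ s) _ (mkRest () _ _ _)
rest-base (NE ∷ SE ∷ s) eq rest = low (rest-base s eq (proj₂ (rest-low rest)))
rest-base (NE ∷ NE ∷ SE ∷ SE ∷ s) eq rest = high (rest-base s eq (proj₂ (rest-high rest)))
rest-base (NE ∷ NE ∷ SE ∷ NE ∷ SE ∷ s) _ rest = ⊥-elim (rest-no-plateau rest)
rest-base (NE ∷ NE ∷ SE ∷ NE ∷ NE ∷ s) _ (mkRest _ _ bound _)
  with s≤s (s≤s ()) ← bound 5 (s≤s (s≤s (s≤s (s≤s (s≤s z≤n)))))
rest-base (NE ∷ NE ∷ NE ∷ s) _ (mkRest _ _ bound _) with s≤s (s≤s ()) ← bound 3 (s≤s (s≤s (s≤s z≤n)))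
rest-base (NE ∷ []) _ (mkRest (ne ()) _ _ _)
rest-base (NE ∷ E ∷ s) _ (mkRest (ne ()) _ _ _)
rest-base (NE ∷ NE ∷ []) _ (mkRest (ne (ne ())) _ _ _)
rest-base (NE ∷ NE ∷ E ∷ s) _ (mkRest (ne (ne ())) _ _ _)
rest-base (NE ∷ NE ∷ SE ∷ []) _ (mkRest (ne (ne (se ()))) _ _ _)
rest-base (NE ∷ NE ∷ SE ∷ E ∷ s) _ (mkRest (ne (ne (se ()))) _ _ _)
rest-base (NE ∷ NE ∷ SE ∷ NE ∷ []) _ (mkRest (ne (ne (se (ne ())))) _ _ _)
rest-base (NE ∷ NE ∷ SE ∷ NE ∷ E ∷ s) _ (mkRest (ne (ne (se (ne ())))) _ _ _)
rest-base (E ∷ []) _ (mkRest _ () _ _)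
rest-base (E ∷ SE ∷ s) _ (mkRest (e ()) _ _ _)
rest-base {c} (E ∷ NE ∷ s) eq rest
  with () ← four-apart c 1 eq (s≤s (s≤s z≤n)) (rest-NE (rest-E rest))
rest-base (E ∷ E ∷ []) _ (mkRest _ () _ _)
rest-base (E ∷ E ∷ SE ∷ s) _ (mkRest (e (e ())) _ _ _)
rest-base {c} (E ∷ E ∷ NE ∷ s) eq rest
  with () ← four-apart c 2 eq (s≤s (s≤s (s≤s z≤n))) (rest-NE (rest-E (rest-E rest)))
rest-base (E ∷ E ∷ E ∷ []) _ (mkRest _ () _ _)
rest-base (E ∷ E ∷ E ∷ SE ∷ s) _ (mkRest (e (e (e ()))) _ _ _)
rest-base {c} (E ∷ E ∷ E ∷ NE ∷ s) eq rest
  with () ← four-apart c 3 eq ≤-refl (rest-NE (rest-E (rest-E (rest-E rest))))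
rest-base (E ∷ E ∷ E ∷ E ∷ []) _ (mkRest _ () _ _)
rest-base (E ∷ E ∷ E ∷ E ∷ s@(_ ∷ _)) eq rest = quad (rest-base s eq (rest-E (rest-E (rest-E (rest-E rest)))))

-- For k = 2 the relative heights 1 and 2 are the only possible ones, so the condition on E steps
-- holds at every peak.
good-base : ∀ {s} → Good 2 0 s → Base s
good-base {s} (W , ends , bound , fours , parity) =
  rest-base {0} s refl (mkRest W (endsWell⇒noFinalE ends) bound
    λ x r pk rel → fours x r pk rel (small r (relHeight-≥1 W pk rel)
      (≤-trans (admissible-≤-height (proj₁ rel)) (bound x (peak-≤length pk)))) , parity x r pk rel)
  where
  small : ∀ r → 1 ≤ r → r ≤ 2 → r ≡ 2 ⊎ r ≡ 1
  small 1 _ _ = inj₂ refl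
  small 2 _ _ = inj₁ refl
  small (suc (suc (suc _))) _ (s≤s (s≤s ()))

-- Codes for paths

quads : ℕ → List Step → List Step
quads zero    s = s
quads (suc t) s = E ∷ E ∷ E ∷ E ∷ quads t s

hill : Bool → List Step → List Step
hill false s = NE ∷ SE ∷ s
hill true  s = NE ∷ NE ∷ SE ∷ SE ∷ s

blocks : List Bool → List ℕ → List Step
blocks (b ∷ bs) (t ∷ ts) = quads t (hill b (blocks bs ts))
blocks _        _        = []

base-quads : ∀ t b {s} → Base s → Base (quads t (hill b s))
base-quads zero          false p = low p
base-quads zero          true  p = high p
base-quads (suc zero)    false p = quad (base-quads zero false p)
base-quads (suc zero)    true  p = quad (base-quads zero true p)
base-quads (suc (suc t)) b     p = quad (base-quads (suc t) b p)

base-blocks : ∀ bs ts → Base (blocks bs ts)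
base-blocks []       ts       = []
base-blocks (b ∷ bs) []       = []
base-blocks (b ∷ bs) (t ∷ ts) = base-quads t b (base-blocks bs ts)

readBlocks : List Step → List Bool × List ℕ
readBlocks (NE ∷ SE ∷ s) =
  let bs , ts = readBlocks s in false ∷ bs , 0 ∷ ts
readBlocks (NE ∷ NE ∷ SE ∷ SE ∷ s) =
  let bs , ts = readBlocks s in true ∷ bs , 0 ∷ ts
readBlocks (E ∷ E ∷ E ∷ E ∷ s) =
  let bs , ts = readBlocks s in bs , bump ts
readBlocks _ = [] , []

readBlocks-blocks : ∀ bs ts → length bs ≡ length ts → readBlocks (blocks bs ts) ≡ (bs , ts)
readBlocks-blocks []       []       _  = refl
readBlocks-blocks (b ∷ bs) (t ∷ ts) eq =
  trans (read-quads t) (cong (λ { (bs , ts) → b ∷ bs , t ∷ ts }) (readBlocks-blocks bs ts (suc-injective eq)))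
  where
  s = blocks bs ts
  read-hill : ∀ b → readBlocks (hill b s) ≡ (b ∷ proj₁ (readBlocks s) , 0 ∷ proj₂ (readBlocks s))
  read-hill false = refl
  read-hill true  = refl
  read-quads : ∀ t → readBlocks (quads t (hill b s)) ≡ (b ∷ proj₁ (readBlocks s) , t ∷ proj₂ (readBlocks s))
  read-quads zero    = read-hill b
  read-quads (suc t) = cong (λ { (bs , ts) → bs , bump ts }) (read-quads t)

blocks-onto : ∀ {s} → Base s → ∃₂ λ bs ts → length bs ≡ length ts × blocks bs ts ≡ s
blocks-onto [] = [] , [] , refl , refl
blocks-onto (quad p) with blocks-onto p
... | b ∷ bs , t ∷ ts , len , eq = b ∷ bs , suc t ∷ ts , len , cong (λ s → E ∷ E ∷ E ∷ E ∷ s) eq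
blocks-onto (low p) =
  let bs , ts , len , eq = blocks-onto p
  in false ∷ bs , 0 ∷ ts , cong suc len , cong (λ s → NE ∷ SE ∷ s) eq
blocks-onto (high p) =
  let bs , ts , len , eq = blocks-onto p
  in true ∷ bs , 0 ∷ ts , cong suc len , cong (λ s → NE ∷ NE ∷ SE ∷ SE ∷ s) eq

peaks-quads : ∀ t s → peaks (quads t s) ≡ peaks s
peaks-quads zero    s = refl
peaks-quads (suc t) s = peaks-quads t s

major-quads : ∀ t s → majorIndex (quads t s) ≡ majorIndex s + 4 * t * peaks s
major-quads zero    s = sym (+-identityʳ _)
major-quads (suc t) s = begin
  majorFrom 4 (quads t s)
    ≡⟨ major-shift 4 (quads t s) ⟩
  majorIndex (quads t s) + 4 * peaks (quads t s)
    ≡⟨ cong₂ (λ m p → m + 4 * p) (major-quads t s) (peaks-quads t s) ⟩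
  majorIndex s + 4 * t * peaks s + 4 * peaks s
    ≡⟨ solve 3 (λ m t p → m :+ con 4 :* t :* p :+ con 4 :* p := m :+ con 4 :* (con 1 :+ t) :* p)
         refl (majorIndex s) t (peaks s) ⟩
  majorIndex s + 4 * suc t * peaks s ∎
  where
  open ≡-Reasoning
  open +-*-Solver

-- With j hills behind it, a high hill instead of a low one moves its own peak by 1 and each later
-- peak by 2.
bitWeight : ℕ → Bool → ℕ
bitWeight j = if_then suc (2 * j) else 0

-- Each group of four E steps moves the next hill and the j hills behind it by 4.
quadWeight : ℕ → ℕ → ℕ
quadWeight j t = 4 * suc j * t

gapWeight₂ : ℕ → ℕ → ℕ
gapWeight₂ j c = 2 * suc j * c

peaks-hill : ∀ b s → peaks (hill b s) ≡ suc (peaks s)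
peaks-hill false s = refl
peaks-hill true  s = refl

major-hill : ∀ b s → majorIndex (hill b s) ≡ suc (2 * peaks s) + majorIndex s + bitWeight (peaks s) b
major-hill false s = trans (cong suc (trans (major-shift 2 s) (+-comm (majorIndex s) _))) (sym (+-identityʳ _))
major-hill true  s =
  trans (cong (2 +_) (major-shift 4 s))
    (solve 2 (λ m p → con 2 :+ (m :+ con 4 :* p)
              := con 1 :+ con 2 :* p :+ m :+ (con 1 :+ con 2 :* p)) refl (majorIndex s) (peaks s))
  where open +-*-Solver

peaks-blocks : ∀ bs ts → length bs ≡ length ts → peaks (blocks bs ts) ≡ length bs
peaks-blocks []       []       _  = refl
peaks-blocks (b ∷ bs) (t ∷ ts) eq =
  trans (peaks-quads t _) (trans (peaks-hill b _) (cong suc (peaks-blocks bs ts (suc-injective eq))))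

major-blocks : ∀ bs ts → length bs ≡ length ts →
  majorIndex (blocks bs ts) ≡ length bs * length bs + (wtDown bitWeight bs + wtDown quadWeight ts)
major-blocks []       []       _  = refl
major-blocks (b ∷ bs) (t ∷ ts) eq = begin
  majorIndex (quads t (hill b s))
    ≡⟨ major-quads t (hill b s) ⟩
  majorIndex (hill b s) + 4 * t * peaks (hill b s)
    ≡⟨ cong₂ (λ m p → m + 4 * t * p) (major-hill b s) (peaks-hill b s) ⟩
  suc (2 * peaks s) + majorIndex s + bitWeight (peaks s) b + 4 * t * suc (peaks s)
    ≡⟨ cong₂ (λ m p → suc (2 * p) + m + bitWeight p b + 4 * t * suc p)
         (major-blocks bs ts (suc-injective eq)) (peaks-blocks bs ts (suc-injective eq)) ⟩
  suc (2 * n) + (n * n + (wb + wt)) + bitWeight n b + 4 * t * suc n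
    ≡⟨ solve 5 (λ n wb wt t x → con 1 :+ con 2 :* n :+ (n :* n :+ (wb :+ wt)) :+ x :+ con 4 :* t :* (con 1 :+ n)
                := (con 1 :+ n) :* (con 1 :+ n) :+ (x :+ wb :+ (con 4 :* (con 1 :+ n) :* t :+ wt)))
         refl n wb wt t (bitWeight n b) ⟩
  suc n * suc n + (bitWeight n b + wb + (4 * suc n * t + wt))
    ≡⟨ cong (λ l → suc n * suc n + (bitWeight n b + wb + (4 * suc l * t + wt))) (suc-injective eq) ⟩
  suc n * suc n + (wtDown bitWeight (b ∷ bs) + wtDown quadWeight (t ∷ ts)) ∎
  where
  open ≡-Reasoning
  open +-*-Solver
  s  = blocks bs ts
  n  = length bs
  wb = wtDown bitWeight bs
  wt = wtDown quadWeight ts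

-- Here d = k - 2. The lists have the lengths n_1, ..., n_(k-1) from the outside inwards; the two
-- innermost lists share the last length. Each entry is the choice made in one factor of the
-- summand.
Code : ℕ → Set
Code zero    = List Bool × List ℕ
Code (suc d) = List ℕ × Code d

Valid : ∀ d → Code d → Set
Valid zero    (bs , ts) = length bs ≡ length ts
Valid (suc d) (cs , c)  = ⊤ × Valid d c

shape : ∀ d → Code d → List ℕ
shape zero    (bs , ts) = length bs ∷ []
shape (suc d) (cs , c)  = length cs ∷ shape d c

weight : ∀ d → Code d → ℕ
weight zero    (bs , ts) = wtDown bitWeight bs + wtDown quadWeight ts
weight (suc d) (cs , c)  = wtDown gapWeight₂ cs + weight d c

length-shape : ∀ d c → length (shape d c) ≡ suc d
length-shape zero    _        = refl
length-shape (suc d) (cs , c) = cong suc (length-shape d c)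

enum-code : ∀ d ns → length ns ≡ suc d → Enum (λ c → Valid d c × shape d c ≡ ns) (weight d) (factor ns)
enum-code zero (x ∷ []) _ = enum-image (λ c → c)
  (λ { _ (p , q) → trans p (sym q) , cong (_∷ []) p })
  (λ _ _ eq → eq)
  (λ { c (p , refl) → c , (refl , sym p) , refl })
  (λ _ _ → refl)
  (enum-× (enum-wtDown bitWeight (λ j → enum-bit (suc (2 * j))) x)
          -- `enum-geom` expects the predecessor of the period: `4 * suc j` unfolds to
          -- `suc (j + 3 * suc j)`.
          (enum-wtDown quadWeight (λ j → enum-geom (j + 3 * suc j)) x))
enum-code (suc d) (x ∷ y ∷ ns) eq = enum-image (λ c → c)
  (λ { _ (p , q , r) → (tt , q) , cong₂ _∷_ p r })
  (λ _ _ eq → eq)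
  (λ { c ((_ , q) , r) → c , (∷-injectiveˡ r , q , ∷-injectiveʳ r) , refl })
  (λ _ _ → refl)
  (enum-× (enum-wtDown gapWeight₂ (λ j → enum-geom (j + 1 * suc j)) x)
          (enum-code d (y ∷ ns) (suc-injective eq)))

-- Recursion for the exponent

parSum-suc : ∀ a i Ns → parSum (suc a) (suc i) Ns ≡ parSum a i Ns
parSum-suc a       i []       = refl
parSum-suc zero    i (N ∷ Ns) = cong₂ _+_ refl (parSum-suc zero (suc i) Ns)
parSum-suc (suc a) i (N ∷ Ns) = cong₂ _+_ refl (parSum-suc (suc a) (suc i) Ns)

-- The indices start at 1 or later, so the even ones are at least 2 anyway.
parSum-0-2 : ∀ i Ns → parSum 0 (suc i) Ns ≡ parSum 2 (suc i) Ns
parSum-0-2 i       []       = refl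
parSum-0-2 zero    (N ∷ Ns) = parSum-0-2 1 Ns
parSum-0-2 (suc i) (N ∷ Ns) = cong₂ _+_ refl (parSum-0-2 (2 + i) Ns)

expo-cons : ∀ a x ns → expo (2 + a) (x ∷ ns) ≡ (x + sum ns) * (x + sum ns) + expo (1 + a) ns
expo-cons a x ns =
  trans (+-assoc ((x + sum ns) * (x + sum ns)) _ _)
    (cong (λ p → (x + sum ns) * (x + sum ns) + (sum (map (λ N → N * N) (suffixSums ns)) + 2 * p))
      (parSum-suc (suc a) 1 (suffixSums ns)))

-- For a = 1 the linear terms are those of N_1, N_3, N_5, ...; without the first entry all indices
-- drop by one, and N_2, N_4, ... are the terms for a = 2.
expo-cons-1 : ∀ x ns → expo 1 (x ∷ ns) ≡ (x + sum ns) * (x + sum ns) + 2 * (x + sum ns) + expo 2 ns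
expo-cons-1 x ns =
  trans
    (solve 3 (λ N s p → N :* N :+ s :+ con 2 :* (N :+ p) := N :* N :+ con 2 :* N :+ (s :+ con 2 :* p))
      refl (x + sum ns) (sum (map (λ N → N * N) (suffixSums ns))) (parSum 1 2 (suffixSums ns)))
    (cong (λ p → (x + sum ns) * (x + sum ns) + 2 * (x + sum ns) + (sum (map (λ N → N * N) (suffixSums ns)) + 2 * p))
      (trans (parSum-suc 0 1 (suffixSums ns)) (parSum-0-2 0 (suffixSums ns))))
  where open +-*-Solver

-- The induction on k

double : List ℕ → List ℕ
double = map (2 *_)

double-even : ∀ cs → All (λ g → g % 2 ≡ 0) (double cs)
double-even []       = []
double-even (c ∷ cs) = even c ∷ double-even cs
  where
  even : ∀ c → (2 * c) % 2 ≡ 0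
  even zero    = refl
  even (suc c) = trans (cong (_% 2) (*-suc 2 c)) (even c)

double-onto : ∀ {gs} → All (λ g → g % 2 ≡ 0) gs → ∃ λ cs → double cs ≡ gs
double-onto [] = [] , refl
double-onto {g ∷ _} (eq ∷ evs) =
  let c , c≡ = half g eq
      cs , cs≡ = double-onto evs
  in c ∷ cs , cong₂ _∷_ c≡ cs≡
  where
  half : ∀ g → g % 2 ≡ 0 → ∃ λ c → 2 * c ≡ g
  half zero          _  = 0 , refl
  half (suc (suc g)) eq = let c , c≡ = half g eq in suc c , trans (*-suc 2 c) (cong (2 +_) c≡)

gapWeight-double : ∀ cs → gapWeight (double cs) ≡ wtDown gapWeight₂ cs
gapWeight-double []       = refl
gapWeight-double (c ∷ cs) = cong₂ _+_
  (trans (cong (λ l → suc l * (2 * c)) (length-map _ cs))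
    (solve 2 (λ l c → (con 1 :+ l) :* (con 2 :* c) := con 2 :* (con 1 :+ l) :* c) refl (length cs) c))
  (gapWeight-double cs)
  where open +-*-Solver

-- The induction hypothesis for k = d + 2: a bijection between codes and good paths with the right
-- weights. The number of peaks is carried along because the next insertion adds its square to the
-- major index.
record Coding (d a : ℕ) : Set where
  field
    build : Code d → List Step
    sound : ∀ c → Valid d c → Good (2 + d) (3 + d ∸ a) (build c)
    inj   : ∀ {c c′} → Valid d c → Valid d c′ → build c ≡ build c′ → c ≡ c′
    onto  : ∀ s → Good (2 + d) (3 + d ∸ a) s → ∃ λ c → Valid d c × build c ≡ s
    peaky : ∀ c → Valid d c → peaks (build c) ≡ sum (shape d c)
    major : ∀ c → Valid d c → majorIndex (build c) ≡ expo a (shape d c) + weight d c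

base-coding : Coding 0 1
base-coding = record
  { build = λ { (bs , ts) → SE ∷ SE ∷ blocks bs ts }
  ; sound = λ { (bs , ts) _ → good-descent (base-good (base-blocks bs ts)) }
  ; inj   = λ { {bs , ts} {bs′ , ts′} v v′ eq →
      trans (sym (readBlocks-blocks bs ts v))
        (trans (cong readBlocks (∷-injectiveʳ (∷-injectiveʳ eq))) (readBlocks-blocks bs′ ts′ v′)) }
  ; onto  = onto
  ; peaky = λ { (bs , ts) v → trans (peaks-blocks bs ts v) (sym (+-identityʳ _)) }
  ; major = λ { (bs , ts) v →
      trans (major-shift 2 (blocks bs ts))
        (trans (cong₂ (λ m p → m + 2 * p) (major-blocks bs ts v) (peaks-blocks bs ts v))
          (solve 2 (λ n w → n :* n :+ w :+ con 2 :* n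
              := (n :+ con 0) :* (n :+ con 0) :+ con 0 :+ con 2 :* (n :+ con 0 :+ con 0) :+ w)
            refl (length bs) (wtDown bitWeight bs + wtDown quadWeight ts))) }
  }
  where
  open +-*-Solver
  onto : ∀ s → Good 2 2 s → ∃ λ c → Valid 0 c × SE ∷ SE ∷ blocks (proj₁ c) (proj₂ c) ≡ s
  onto s good with good-top good
  ... | s′ , refl =
    let bs , ts , len , eq = blocks-onto (good-base (good-descent⁻ good))
    in (bs , ts) , len , cong (λ s → SE ∷ SE ∷ s) eq

module _ {d a : ℕ} (C : Coding d a) where
  open Coding C

  private
    K = 2 + d
    h = 3 + d ∸ a

    raised : Code (suc d) → List Step
    raised (cs , c) = insert (double cs) (build c)

    ins : ∀ cs c → Ins (double cs) (build c) (raised (cs , c))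
    ins cs c = Ins-insert (double cs) (build c)

    raised-sound : ∀ c → Valid (suc d) c → Good (suc K) h (raised c)
    raised-sound (cs , c) (_ , v) =
      good-raise (s≤s (s≤s z≤n)) (ins cs c) (evenFrom-even (double cs) refl (double-even cs)) (sound c v)

    raised-inj : ∀ {c c′} → Valid (suc d) c → Valid (suc d) c′ → raised c ≡ raised c′ → c ≡ c′
    raised-inj {cs , c} {cs′ , c′} (_ , v) (_ , v′) eq =
      let parsed = trans (sym (parse-Ins (ins cs c) (ok c v)))
                     (trans (cong parse eq) (parse-Ins (ins cs′ c′) (ok c′ v′)))
      in cong₂ _,_ (map-injective (λ {x} {y} → *-cancelˡ-≡ x y 2) (cong proj₁ parsed))
           (inj v v′ (cong proj₂ parsed))
      where
      ok : ∀ c → Valid d c → NoFinalE (build c)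
      ok c v = endsWell⇒noFinalE (proj₁ (proj₂ (sound c v)))

    raised-onto : h ≤ K → ∀ s → Good (suc K) h s → ∃ λ c → Valid (suc d) c × raised c ≡ s
    raised-onto h≤K s good =
      let D = Ins-parse s (endsWell⇒noFinalE (proj₁ (proj₂ good)))
          gs , w = parse s
          good′ , ev = good-raise⁻ (s≤s z≤n) h≤K D (parse-noFinalE s) good
          c , v , c≡ = onto w good′
          cs , cs≡ = double-onto (evenFrom-even⁻ gs refl ev)
      in (cs , c) , (tt , v) , trans (cong₂ insert cs≡ c≡) (Ins-functional D)

    raised-peaks : ∀ c → Valid (suc d) c → peaks (raised c) ≡ sum (shape (suc d) c)
    raised-peaks (cs , c) (_ , v) =
      trans (peaks-Ins (ins cs c)) (cong₂ _+_ (length-map _ cs) (peaky c v))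

    raised-major : ∀ c → Valid (suc d) c → majorIndex (raised c) ≡
      sum (shape (suc d) c) * sum (shape (suc d) c) + expo a (shape d (proj₂ c)) + weight (suc d) c
    raised-major (cs , c) (_ , v) = begin
      majorIndex (raised (cs , c))
        ≡⟨ major-Ins (ins cs c) ⟩
      (length (double cs) + peaks (build c)) * (length (double cs) + peaks (build c))
        + majorIndex (build c) + gapWeight (double cs)
        ≡⟨ cong₂ (λ n m → n * n + m + gapWeight (double cs)) (cong₂ _+_ (length-map _ cs) (peaky c v)) (major c v) ⟩
      N * N + (expo a (shape d c) + weight d c) + gapWeight (double cs)
        ≡⟨ cong (N * N + (expo a (shape d c) + weight d c) +_) (gapWeight-double cs) ⟩
      N * N + (expo a (shape d c) + weight d c) + wtDown gapWeight₂ cs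
        ≡⟨ solve 4 (λ n x w g → n :+ (x :+ w) :+ g := n :+ x :+ (g :+ w))
             refl (N * N) (expo a (shape d c)) (weight d c) (wtDown gapWeight₂ cs) ⟩
      N * N + expo a (shape d c) + weight (suc d) (cs , c) ∎
      where
      open ≡-Reasoning
      open +-*-Solver
      N = length cs + sum (shape d c)

  -- The starting height is unchanged, and positivity of a keeps it within the smaller bound on
  -- heights.
  raise-coding : ∀ {a′} → a ≡ suc a′ → Coding (suc d) (suc a)
  raise-coding {a′} refl = record
    { build = raised
    ; sound = raised-sound
    ; inj   = raised-inj
    ; onto  = raised-onto (m∸n≤m K a′)
    ; peaky = raised-peaks
    ; major = λ { (cs , c) v → trans (raised-major (cs , c) v)
        (cong (_+ weight (suc d) (cs , c)) (sym (expo-cons a′ (length cs) (shape d c)))) }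
    }

  -- Paths for a = 2 start at height d + 1, exactly two below the new maximal height d + 3. The two
  -- SE steps move all N peaks by 2, which accounts for the term 2 N_1.
  descend-coding : a ≡ 2 → Coding (suc d) 1
  descend-coding refl = record
    { build = λ c → SE ∷ SE ∷ raised c
    ; sound = λ c v → good-descent (raised-sound c v)
    ; inj   = λ v v′ eq → raised-inj v v′ (∷-injectiveʳ (∷-injectiveʳ eq))
    ; onto  = descended-onto
    ; peaky = raised-peaks
    ; major = λ c v → trans (major-shift 2 (raised c))
        (trans (cong₂ (λ m p → m + 2 * p) (raised-major c v) (raised-peaks c v))
          (trans (solve 3 (λ n x w → n :* n :+ x :+ w :+ con 2 :* n := n :* n :+ con 2 :* n :+ x :+ w)
                   refl (sum (shape (suc d) c)) (expo 2 (shape d (proj₂ c))) (weight (suc d) c))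
            (cong (_+ weight (suc d) c) (sym (expo-cons-1 (length (proj₁ c)) (shape d (proj₂ c)))))))
    }
    where
    open +-*-Solver
    descended-onto : ∀ s → Good (suc K) (suc K) s → ∃ λ c → Valid (suc d) c × SE ∷ SE ∷ raised c ≡ s
    descended-onto s good with good-top good
    ... | s′ , refl =
      let c , v , eq = raised-onto (n≤1+n _) s′ (good-descent⁻ good)
      in c , v , cong (λ s → SE ∷ SE ∷ s) eq

-- Both reductions, to (k - 1, a - 1) and from (k, 1) to (k - 1, 2), preserve the parity of k - a;
-- hence the recursion ends at (2, 1) and never at (2, 2).
coding : ∀ d a → 1 ≤ a → a ≤ 2 + d → (2 + d) % 2 ≢ a % 2 → Coding d a
coding zero 1 _ _ _ = base-coding
coding zero 2 _ _ odd = ⊥-elim (odd refl)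
coding zero (suc (suc (suc _))) _ (s≤s (s≤s ())) _
coding (suc d) 1 _ _ odd =
  descend-coding (coding d 2 (s≤s z≤n) (s≤s (s≤s z≤n)) (λ eq → odd (suc-%2 (2 + d) 2 eq))) refl
coding (suc d) (suc (suc a)) _ (s≤s a≤) odd =
  raise-coding (coding d (suc a) (s≤s z≤n) a≤ (λ eq → odd (suc-%2 (2 + d) (suc a) eq))) refl

-- Summation over the tuples

prepend-unique : ∀ {A : Set} (xs : List A) (yss : List (List A)) → Unique xs → Unique yss →
  Unique (concatMap (λ x → map (x ∷_) yss) xs)
prepend-unique []       yss _ _ = []
prepend-unique (x ∷ xs) yss (x∉ ∷ u) v =
  Uniqueₚ.++⁺ (Uniqueₚ.map⁺ ∷-injectiveʳ v) (prepend-unique xs yss u v) disjoint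
  where
  head∈ : ∀ zs {y ys} → y ∷ ys ∈ concatMap (λ x → map (x ∷_) yss) zs → y ∈ zs
  head∈ (z ∷ zs) m with ∈-++⁻ (map (z ∷_) yss) m
  ... | inj₂ m′ = there (head∈ zs m′)
  ... | inj₁ m′ with _ , _ , refl ← ∈-map⁻ (z ∷_) m′ = here refl
  disjoint : ∀ {ys} → ¬ (ys ∈ map (x ∷_) yss × ys ∈ concatMap (λ x → map (x ∷_) yss) xs)
  disjoint (p , q) with _ , _ , refl ← ∈-map⁻ (x ∷_) p = All.lookup x∉ (head∈ xs q) refl

tuples-unique : ∀ m B → Unique (tuples m B)
tuples-unique zero    B = [] ∷ []
tuples-unique (suc m) B = prepend-unique (upTo (suc B)) (tuples m B) (Uniqueₚ.upTo⁺ (suc B)) (tuples-unique m B)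

∈-prepend : ∀ {A : Set} {x : A} {xs ys : List A} {yss : List (List A)} →
  x ∈ xs → ys ∈ yss → x ∷ ys ∈ concatMap (λ x → map (x ∷_) yss) xs
∈-prepend {xs = x ∷ xs} {yss = yss} (here refl) q = ∈-++⁺ˡ (∈-map⁺ (x ∷_) q)
∈-prepend {xs = x ∷ xs} {yss = yss} (there p)   q = ∈-++⁺ʳ (map (x ∷_) yss) (∈-prepend p q)

∈-tuples : ∀ {m B ns} → length ns ≡ m → All (_≤ B) ns → ns ∈ tuples m B
∈-tuples {zero}  {ns = []}     _  _        = here refl
∈-tuples {suc m} {ns = n ∷ ns} eq (p ∷ ps) = ∈-prepend (∈-upTo⁺ (s≤s p)) (∈-tuples (suc-injective eq) ps)

length-∈-tuples : ∀ m B {ns} → ns ∈ tuples m B → length ns ≡ m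
length-∈-tuples zero B (here refl) = refl
length-∈-tuples (suc m) B = go (upTo (suc B))
  where
  go : ∀ xs {ns} → ns ∈ concatMap (λ x → map (x ∷_) (tuples m B)) xs → length ns ≡ suc m
  go (x ∷ xs) p with ∈-++⁻ (map (x ∷_) (tuples m B)) p
  ... | inj₂ q = go xs q
  ... | inj₁ q with ys , ys∈ , refl ← ∈-map⁻ (x ∷_) q = cong suc (length-∈-tuples m B ys∈)

n≤n*n : ∀ n → n ≤ n * n
n≤n*n zero    = z≤n
n≤n*n (suc n) = m≤m+n (suc n) _

-- Each n_i is at most N_i and so at most its square. Tuples contributing to the coefficient of q^n
-- therefore have entries up to n, and truncation at B ≥ n loses nothing.
entries-≤-expo : ∀ a ns → All (_≤ expo a ns) ns
entries-≤-expo a ns = All.map (λ p → ≤-trans p (m≤m+n _ _)) (entries-≤-squares ns)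
  where
  entries-≤-squares : ∀ ns → All (_≤ sum (map (λ N → N * N) (suffixSums ns))) ns
  entries-≤-squares []       = []
  entries-≤-squares (n ∷ ns) =
    ≤-trans (≤-trans (m≤m+n n (sum ns)) (n≤n*n (n + sum ns))) (m≤m+n _ _) ∷
    All.map (λ p → ≤-trans p (m≤n+m _ _)) (entries-≤-squares ns)

sumS-map : ∀ {I : Set} (f : I → Series) is n → sumS (map f is) n ≡ sum (map (λ i → f i n) is)
sumS-map f []       n = refl
sumS-map f (i ∷ is) n = cong (f i n +_) (sumS-map f is n)

theorem1p6 : (k a : ℕ) → 1 ≤ a → a ≤ k → k % 2 ≢ a % 2 →
    (n B : ℕ) → n ≤ B → HasCount (SPath k a n) (rhsTrunc k a B n)
theorem1p6 zero    a 1≤a a≤k odd n B n≤B = ⊥-elim (n≮0 (≤-trans 1≤a a≤k))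
theorem1p6 (suc zero) a 1≤a a≤k odd n B n≤B = ⊥-elim (odd (cong (_% 2) (≤-antisym 1≤a a≤k)))
theorem1p6 (suc (suc d)) a 1≤a a≤k odd n B n≤B =
  subst (HasCount (SPath (2 + d) a n)) (sym (sumS-map (term a) (tuples (suc d) B) n))
    (count-image build
      (λ { c ((v , eq) , _) →
          let W , ends , bound , fours , parity = sound c v
          in W , ends , bound , fours , parity , trans (major c v) eq })
      (λ { ((v , _) , _) ((v′ , _) , _) → inj v v′ })
      (λ { s (W , ends , bound , fours , parity , maj) →
          let c , v , eq = onto s (W , ends , bound , fours , parity)
              total = trans (sym (major c v)) (trans (cong majorIndex eq) maj)
          in c , ((v , total) , small c total) , eq })
      -- Codes are sorted by their lengths (n_1, ..., n_(k-1)); each tuple accounts for one summand.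
      (count-fibres (shape d) (λ ns → term a ns n) (tuples (suc d) B) (tuples-unique (suc d) B)
        (λ ns ns∈ → count-cong
          (λ { c ((v , refl) , eq) → (v , eq) , refl })
          (λ { c ((v , eq) , refl) → (v , refl) , eq })
          (enum-shift (expo a ns) (enum-code d ns (length-∈-tuples (suc d) B ns∈)) n))))
  where
  open Coding (coding d a 1≤a a≤k odd)
  small : ∀ c → expo a (shape d c) + weight d c ≡ n → shape d c ∈ tuples (suc d) B
  small c total = ∈-tuples (length-shape d c)
    (All.map (λ p → ≤-trans p (≤-trans (m≤m+n _ _) (≤-trans (≤-reflexive total) n≤B)))
      (entries-≤-expo a (shape d c)))
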